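{- Let $|q|<1$ and let $x,y$ be complex numbers. Then $$\sum_{k=0}^\infty\frac{(-1)^k y^k q^{\binom{k}{2}}}{(q;q)_k}\sum_{n=k}^\infty\sum_{m=k}^\infty h_{n+m-k}(x,y|q)\frac{t^n}{(q;q)_{n-k}}\frac{s^m}{(q;q)_{m-k}}=(xst;q)_\infty\sum_{n=0}^\infty\sum_{m=0}^\infty h_n(x,y|q)\,h_m(x,y|q)\frac{t^n}{(q;q)_n}\frac{s^m}{(q;q)_m}.$$
   Context: Throughout $|q|<1$. $(a;q)_n=\prod_{j=0}^{n-1}(1-aq^j)$, $(a;q)_\infty=\prod_{j\ge0}(1-aq^j)$, ${n\brack k}=\frac{(q;q)_n}{(q;q)_k(q;q)_{n-k}}$. $P_n(x,y)=(x-y)(x-qy)\cdots(x-q^{n-1}y)$ with $P_0=1$, and $h_n(x,y|q)=\sum_{k=0}^n{n\brack k}P_k(x,y)$. -}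

module Defs where

open import Algebra.Bundles using (RawRing)
import Algebra.Definitions.RawSemiring as RawSemiringDefs
open import Data.Nat.Base as ℕ using (ℕ; zero; suc; _∸_)
import Data.Nat.Properties as ℕ
open import Data.Product.Base using (Σ-syntax; ∃-syntax; _×_; _,_)
open import Data.Rational.Base as ℚ using (ℚ; 0ℚ; 1ℚ; ½)
import Data.Rational.Properties as ℚ
open import Data.Rational.Solver using (module +-*-Solver)
open import Data.Sum.Base using (inj₁; inj₂)
open import Level using (0ℓ)
open import Relation.Binary.PropositionalEquality
  using (_≡_; refl; sym; trans; cong; cong₂; subst; subst₂)

open +-*-Solver using (solve; _:+_; _:*_; _:-_; :-_; _:=_; con)

private
  *-pos : ∀ {p q} → 0ℚ ℚ.< p → 0ℚ ℚ.< q → 0ℚ ℚ.< p ℚ.* q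
  *-pos {p} {q} 0<p 0<q = ℚ.positive⁻¹ (p ℚ.* q)
    {{ℚ.pos*pos⇒pos p {{ℚ.positive 0<p}} q {{ℚ.positive 0<q}}}}

  *-monoˡ : ∀ {p q} r → 0ℚ ℚ.≤ r → p ℚ.≤ q → r ℚ.* p ℚ.≤ r ℚ.* q
  *-monoˡ r 0≤r = ℚ.*-monoˡ-≤-nonNeg r {{ℚ.nonNegative 0≤r}}

  *-mono : ∀ {p q r s} → 0ℚ ℚ.≤ q → 0ℚ ℚ.≤ r → p ℚ.≤ q → r ℚ.≤ s →
           p ℚ.* r ℚ.≤ q ℚ.* s
  *-mono {q = q} {r} 0≤q 0≤r p≤q r≤s = ℚ.≤-trans
    (ℚ.*-monoʳ-≤-nonNeg r {{ℚ.nonNegative 0≤r}} p≤q) (*-monoˡ q 0≤q r≤s)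

  *-mono-<-pos : ∀ {p q} r → 0ℚ ℚ.< r → p ℚ.< q → r ℚ.* p ℚ.< r ℚ.* q
  *-mono-<-pos r 0<r = ℚ.*-monoʳ-<-pos r {{ℚ.positive 0<r}}

  ½-pos : ∀ {p} → 0ℚ ℚ.< p → 0ℚ ℚ.< ½ ℚ.* p
  ½-pos = *-pos (ℚ.positive⁻¹ ½)

  ½+½ : ∀ p → ½ ℚ.* p ℚ.+ ½ ℚ.* p ≡ p
  ½+½ = solve 1 (λ p → con ½ :* p :+ con ½ :* p := p) refl

  0≤sq : ∀ p → 0ℚ ℚ.≤ p ℚ.* p
  0≤sq p with ℚ.≤-total 0ℚ p
  ... | inj₁ 0≤p = subst (ℚ._≤ p ℚ.* p) (ℚ.*-zeroʳ p) (*-monoˡ p 0≤p 0≤p)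
  ... | inj₂ p≤0 = subst (ℚ._≤ p ℚ.* p) (ℚ.*-zeroʳ p)
    (ℚ.*-monoˡ-≤-nonPos p {{ℚ.nonPositive p≤0}} p≤0)

  neg-diff : ∀ a b → ℚ.- (a ℚ.- b) ≡ ℚ.- a ℚ.- ℚ.- b
  neg-diff = solve 2 (λ a b → :- (a :- b) := :- a :- :- b) refl

  neg-swap : ∀ a b → b ℚ.- a ≡ ℚ.- (a ℚ.- b)
  neg-swap = solve 2 (λ a b → b :- a := :- (a :- b)) refl

  diff-+ : ∀ a b c d → (a ℚ.- c) ℚ.+ (b ℚ.- d) ≡ (a ℚ.+ b) ℚ.- (c ℚ.+ d)
  diff-+ = solve 4 (λ a b c d → (a :- c) :+ (b :- d) := (a :+ b) :- (c :+ d)) refl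

  diff-cancel : ∀ a b → (a ℚ.- b) ℚ.+ b ≡ a
  diff-cancel = solve 2 (λ a b → (a :- b) :+ b := a) refl

  diff-* : ∀ a b c d → a ℚ.* (b ℚ.- d) ℚ.+ d ℚ.* (a ℚ.- c) ≡ a ℚ.* b ℚ.- c ℚ.* d
  diff-* = solve 4 (λ a b c d → a :* (b :- d) :+ d :* (a :- c) := a :* b :- c :* d) refl

  factor : ∀ a b e k → a ℚ.* (e ℚ.* k) ℚ.+ b ℚ.* (e ℚ.* k) ≡ e ℚ.* ((a ℚ.+ b) ℚ.* k)
  factor = solve 4 (λ a b e k → a :* (e :* k) :+ b :* (e :* k) := e :* ((a :+ b) :* k)) refl

  cross-mult : ∀ a b c d →
    (c ℚ.- d) ℚ.* (a ℚ.* b) ≡ (a ℚ.* c) ℚ.* b ℚ.- (b ℚ.* d) ℚ.* a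
  cross-mult =
    solve 4 (λ a b c d → (c :- d) :* (a :* b) := (a :* c) :* b :- (b :* d) :* a) refl

  two-squares : ∀ a b c d →
    (a ℚ.* c ℚ.+ ℚ.- (b ℚ.* d)) ℚ.* (a ℚ.* c ℚ.+ ℚ.- (b ℚ.* d))
      ℚ.+ (a ℚ.* d ℚ.+ b ℚ.* c) ℚ.* (a ℚ.* d ℚ.+ b ℚ.* c)
    ≡ (a ℚ.* a ℚ.+ b ℚ.* b) ℚ.* (c ℚ.* c ℚ.+ d ℚ.* d)
  two-squares = solve 4
    (λ a b c d → (a :* c :+ :- (b :* d)) :* (a :* c :+ :- (b :* d))
                 :+ (a :* d :+ b :* c) :* (a :* d :+ b :* c)
              := (a :* a :+ b :* b) :* (c :* c :+ d :* d))
    refl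

  -- 2(1 - a) = (1 - a)² + (1 - a²)
  half-gap : ∀ a b e →
    ½ ℚ.* e ℚ.+ ½ ℚ.* ((1ℚ ℚ.- a) ℚ.* (1ℚ ℚ.- a) ℚ.+ b ℚ.* b
                         ℚ.+ (1ℚ ℚ.- (a ℚ.* a ℚ.+ b ℚ.* b ℚ.+ e)))
    ≡ 1ℚ ℚ.- a
  half-gap = solve 3
    (λ a b e → con ½ :* e :+ con ½ :* ((con 1ℚ :- a) :* (con 1ℚ :- a) :+ b :* b
                                         :+ (con 1ℚ :- (a :* a :+ b :* b :+ e)))
            := con 1ℚ :- a)
    refl

-- ℝ is the setoid of Cauchy sequences of rationals with a modulus; all operations
-- are termwise, and _≈ᴿ_ is the equality.

IsCauchy : (ℕ → ℚ) → Set
IsCauchy s = ∀ ε → 0ℚ ℚ.< ε →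
  ∃[ N ] (∀ m n → N ℕ.≤ m → N ℕ.≤ n → ℚ.∣ s m ℚ.- s n ∣ ℚ.< ε)

record ℝ : Set where
  constructor mkℝ
  field
    seq    : ℕ → ℚ
    cauchy : IsCauchy seq

open ℝ public

infix 4 _≈ᴿ_ _<ᴿ_

_≈ᴿ_ : ℝ → ℝ → Set
x ≈ᴿ y = ∀ ε → 0ℚ ℚ.< ε →
  ∃[ N ] (∀ n → N ℕ.≤ n → ℚ.∣ seq x n ℚ.- seq y n ∣ ℚ.< ε)

-- The gap ε is uniform in n, so this is strict order of the limits.
_<ᴿ_ : ℝ → ℝ → Set
x <ᴿ y = ∃[ ε ] ∃[ N ] (0ℚ ℚ.< ε × (∀ n → N ℕ.≤ n → seq x n ℚ.+ ε ℚ.≤ seq y n))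

abstract
  const-cauchy : ∀ p → IsCauchy (λ _ → p)
  const-cauchy p ε 0<ε =
    0 , λ _ _ _ _ → subst (ℚ._< ε) (cong ℚ.∣_∣ (sym (ℚ.+-inverseʳ p))) 0<ε

  neg-cauchy : ∀ s → IsCauchy s → IsCauchy (λ n → ℚ.- s n)
  neg-cauchy s cs ε 0<ε = let N , close = cs ε 0<ε in N , λ m n N≤m N≤n →
    subst (ℚ._< ε)
      (trans (sym (ℚ.∣-p∣≡∣p∣ (s m ℚ.- s n)))
             (cong ℚ.∣_∣ (neg-diff (s m) (s n))))
      (close m n N≤m N≤n)

  +-cauchy : ∀ s t → IsCauchy s → IsCauchy t → IsCauchy (λ n → s n ℚ.+ t n)
  +-cauchy s t cs ct ε 0<ε =
    let M , close-s = cs (½ ℚ.* ε) (½-pos 0<ε)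
        N , close-t = ct (½ ℚ.* ε) (½-pos 0<ε)
    in M ℕ.⊔ N , λ m n ≤m ≤n →
    let m₁ = ℕ.m⊔n≤o⇒m≤o M N ≤m ; m₂ = ℕ.m⊔n≤o⇒n≤o M N ≤m
        n₁ = ℕ.m⊔n≤o⇒m≤o M N ≤n ; n₂ = ℕ.m⊔n≤o⇒n≤o M N ≤n
    in subst₂ ℚ._<_
         (cong ℚ.∣_∣ (diff-+ (s m) (t m) (s n) (t n)))
         (½+½ ε)
         (ℚ.≤-<-trans (ℚ.∣p+q∣≤∣p∣+∣q∣ (s m ℚ.- s n) (t m ℚ.- t n))
                      (ℚ.+-mono-< (close-s m n m₁ n₁) (close-t m n m₂ n₂)))

  cauchy-bounded : ∀ s → IsCauchy s →
    ∃[ B ] ∃[ N ] (0ℚ ℚ.< B × (∀ n → N ℕ.≤ n → ℚ.∣ s n ∣ ℚ.≤ B))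
  cauchy-bounded s cs = within 1ℚ (ℚ.positive⁻¹ 1ℚ)
    where
    within : ∀ c → 0ℚ ℚ.< c → ∃[ B ] ∃[ N ] (0ℚ ℚ.< B × (∀ n → N ℕ.≤ n → ℚ.∣ s n ∣ ℚ.≤ B))
    within c 0<c with cs c 0<c
    ... | N , close =
      c ℚ.+ ℚ.∣ s N ∣ , N , ℚ.+-mono-<-≤ 0<c (ℚ.0≤∣p∣ (s N)) , λ n N≤n →
        subst (λ r → ℚ.∣ r ∣ ℚ.≤ c ℚ.+ ℚ.∣ s N ∣)
          (diff-cancel (s n) (s N))
          (ℚ.≤-trans (ℚ.∣p+q∣≤∣p∣+∣q∣ (s n ℚ.- s N) (s N))
            (ℚ.+-monoˡ-≤ ℚ.∣ s N ∣ (ℚ.<⇒≤ (close n N N≤n ℕ.≤-refl))))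

  product-close : ∀ A B δ a b c d → 0ℚ ℚ.< A → 0ℚ ℚ.< B →
    ℚ.∣ a ∣ ℚ.≤ A → ℚ.∣ d ∣ ℚ.≤ B → ℚ.∣ a ℚ.- c ∣ ℚ.< δ → ℚ.∣ b ℚ.- d ∣ ℚ.< δ →
    ℚ.∣ a ℚ.* b ℚ.- c ℚ.* d ∣ ℚ.< A ℚ.* δ ℚ.+ B ℚ.* δ
  product-close A B δ a b c d 0<A 0<B a≤A d≤B a-c<δ b-d<δ =
    subst (λ r → ℚ.∣ r ∣ ℚ.< A ℚ.* δ ℚ.+ B ℚ.* δ) (diff-* a b c d)
      (ℚ.≤-<-trans (ℚ.∣p+q∣≤∣p∣+∣q∣ (a ℚ.* (b ℚ.- d)) (d ℚ.* (a ℚ.- c)))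
        (ℚ.+-mono-< (bound A a (b ℚ.- d) 0<A a≤A b-d<δ) (bound B d (a ℚ.- c) 0<B d≤B a-c<δ)))
    where
    bound : ∀ K u v → 0ℚ ℚ.< K → ℚ.∣ u ∣ ℚ.≤ K → ℚ.∣ v ∣ ℚ.< δ → ℚ.∣ u ℚ.* v ∣ ℚ.< K ℚ.* δ
    bound K u v 0<K u≤K v<δ = subst (ℚ._< K ℚ.* δ) (sym (ℚ.∣p*q∣≡∣p∣*∣q∣ u v))
      (ℚ.≤-<-trans (ℚ.*-monoʳ-≤-nonNeg ℚ.∣ v ∣ {{ℚ.nonNegative (ℚ.0≤∣p∣ v)}} u≤K)
                   (*-mono-<-pos K 0<K v<δ))

  pos-inverse : ∀ p → 0ℚ ℚ.< p → ∃[ r ] (0ℚ ℚ.< r × p ℚ.* r ≡ 1ℚ)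
  pos-inverse p 0<p =
    ℚ.1/_ p {{ℚ.pos⇒nonZero p {{ℚ.positive 0<p}}}} ,
    ℚ.positive⁻¹ _ {{ℚ.1/pos⇒pos p {{ℚ.positive 0<p}}}} ,
    ℚ.*-inverseʳ p {{ℚ.pos⇒nonZero p {{ℚ.positive 0<p}}}}

  split-ε : ∀ A B ε → 0ℚ ℚ.< A → 0ℚ ℚ.< B → 0ℚ ℚ.< ε →
    ∃[ δ ] (0ℚ ℚ.< δ × A ℚ.* δ ℚ.+ B ℚ.* δ ≡ ε)
  split-ε A B ε 0<A 0<B 0<ε with pos-inverse (A ℚ.+ B) (ℚ.+-mono-< 0<A 0<B)
  ... | r , 0<r , inverse = ε ℚ.* r , *-pos 0<ε 0<r ,
    trans (factor A B ε r) (trans (cong (ε ℚ.*_) inverse) (ℚ.*-identityʳ ε))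

  *-cauchy : ∀ s t → IsCauchy s → IsCauchy t → IsCauchy (λ n → s n ℚ.* t n)
  *-cauchy s t cs ct ε 0<ε =
    let A , M₁ , 0<A , s≤A = cauchy-bounded s cs
        B , M₂ , 0<B , t≤B = cauchy-bounded t ct
        δ , 0<δ , Aδ+Bδ≡ε  = split-ε A B ε 0<A 0<B 0<ε
        N₁ , close-s       = cs δ 0<δ
        N₂ , close-t       = ct δ 0<δ
        M                  = M₁ ℕ.⊔ M₂
        N                  = N₁ ℕ.⊔ N₂
    in M ℕ.⊔ N , λ m n ≤m ≤n →
      let N≤m = ℕ.m⊔n≤o⇒n≤o M N ≤m
          N≤n = ℕ.m⊔n≤o⇒n≤o M N ≤n
      in subst (ℚ.∣ s m ℚ.* t m ℚ.- s n ℚ.* t n ∣ ℚ.<_) Aδ+Bδ≡ε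
           (product-close A B δ (s m) (t m) (s n) (t n) 0<A 0<B
             (s≤A m (ℕ.m⊔n≤o⇒m≤o M₁ M₂ (ℕ.m⊔n≤o⇒m≤o M N ≤m)))
             (t≤B n (ℕ.m⊔n≤o⇒n≤o M₁ M₂ (ℕ.m⊔n≤o⇒m≤o M N ≤n)))
             (close-s m n (ℕ.m⊔n≤o⇒m≤o N₁ N₂ N≤m) (ℕ.m⊔n≤o⇒m≤o N₁ N₂ N≤n))
             (close-t m n (ℕ.m⊔n≤o⇒n≤o N₁ N₂ N≤m) (ℕ.m⊔n≤o⇒n≤o N₁ N₂ N≤n)))

constᴿ : ℚ → ℝ
constᴿ p = mkℝ (λ _ → p) (const-cauchy p)

0ᴿ 1ᴿ : ℝ
0ᴿ = constᴿ 0ℚ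
1ᴿ = constᴿ 1ℚ

infix  8 -ᴿ_
infixl 7 _*ᴿ_
infixl 6 _+ᴿ_

_+ᴿ_ _*ᴿ_ : ℝ → ℝ → ℝ
x +ᴿ y = mkℝ (λ n → seq x n ℚ.+ seq y n) (+-cauchy (seq x) (seq y) (cauchy x) (cauchy y))
x *ᴿ y = mkℝ (λ n → seq x n ℚ.* seq y n) (*-cauchy (seq x) (seq y) (cauchy x) (cauchy y))

-ᴿ_ : ℝ → ℝ
-ᴿ x = mkℝ (λ n → ℚ.- seq x n) (neg-cauchy (seq x) (cauchy x))

-- 1/max(p,ε). If 0 <ᴿ x with gap ε then the terms p of x are eventually ≥ ε, so
-- the truncation, which makes every term invertible, does not change the limit.
recip⊔ : (ε : ℚ) → 0ℚ ℚ.< ε → ℚ → ℚ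
recip⊔ ε 0<ε p = ℚ.1/_ (p ℚ.⊔ ε)
  {{ℚ.pos⇒nonZero (p ℚ.⊔ ε) {{ℚ.positive (ℚ.<-≤-trans 0<ε (ℚ.p≤q⊔p p ε))}}}}

abstract
  recip⊔-inverse : ∀ ε (0<ε : 0ℚ ℚ.< ε) p → ε ℚ.≤ p → p ℚ.* recip⊔ ε 0<ε p ≡ 1ℚ
  recip⊔-inverse ε 0<ε p ε≤p =
    trans (cong (ℚ._* recip⊔ ε 0<ε p) (sym (ℚ.p≥q⇒p⊔q≡p ε≤p)))
          (ℚ.*-inverseʳ (p ℚ.⊔ ε)
            {{ℚ.pos⇒nonZero (p ℚ.⊔ ε) {{ℚ.positive (ℚ.<-≤-trans 0<ε (ℚ.p≤q⊔p p ε))}}}})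

  recip-cauchy : ∀ x ((ε , N , 0<ε , _) : 0ᴿ <ᴿ x) → IsCauchy (λ n → recip⊔ ε 0<ε (seq x n))
  recip-cauchy x (ε , N , 0<ε , lower) η 0<η =
    let M , close = cauchy x (η ℚ.* (ε ℚ.* ε)) (*-pos 0<η (*-pos 0<ε 0<ε))
    in N ℕ.⊔ M , λ m n ≤m ≤n →
    bound (seq x m) (seq x n)
      (above m (ℕ.m⊔n≤o⇒m≤o N M ≤m)) (above n (ℕ.m⊔n≤o⇒m≤o N M ≤n))
      (close m n (ℕ.m⊔n≤o⇒n≤o N M ≤m) (ℕ.m⊔n≤o⇒n≤o N M ≤n))
    where
    above : ∀ n → N ℕ.≤ n → ε ℚ.≤ seq x n
    above n N≤n = subst (ℚ._≤ seq x n) (ℚ.+-identityˡ ε) (lower n N≤n)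
    0≤ε : 0ℚ ℚ.≤ ε
    0≤ε = ℚ.<⇒≤ 0<ε
    bound : ∀ a b → ε ℚ.≤ a → ε ℚ.≤ b → ℚ.∣ a ℚ.- b ∣ ℚ.< η ℚ.* (ε ℚ.* ε) →
            ℚ.∣ recip⊔ ε 0<ε a ℚ.- recip⊔ ε 0<ε b ∣ ℚ.< η
    bound a b ε≤a ε≤b a-b< = ℚ.*-cancelʳ-<-nonNeg (a ℚ.* b) {{ℚ.nonNegative 0≤ab}}
      (ℚ.<-≤-trans (subst (ℚ._< η ℚ.* (ε ℚ.* ε)) (sym scaled) a-b<)
                   (*-monoˡ η (ℚ.<⇒≤ 0<η) ε²≤ab))
      where
      a⁻¹ b⁻¹ : ℚ
      a⁻¹ = recip⊔ ε 0<ε a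
      b⁻¹ = recip⊔ ε 0<ε b
      ε²≤ab : ε ℚ.* ε ℚ.≤ a ℚ.* b
      ε²≤ab = *-mono (ℚ.≤-trans 0≤ε ε≤a) 0≤ε ε≤a ε≤b
      0≤ab : 0ℚ ℚ.≤ a ℚ.* b
      0≤ab = ℚ.≤-trans (0≤sq ε) ε²≤ab
      cross : (a⁻¹ ℚ.- b⁻¹) ℚ.* (a ℚ.* b) ≡ b ℚ.- a
      cross = trans
        (cross-mult a b a⁻¹ b⁻¹)
        (trans (cong₂ (λ u v → u ℚ.* b ℚ.- v ℚ.* a)
                  (recip⊔-inverse ε 0<ε a ε≤a) (recip⊔-inverse ε 0<ε b ε≤b))
               (cong₂ ℚ._-_ (ℚ.*-identityˡ b) (ℚ.*-identityˡ a)))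
      scaled : ℚ.∣ a⁻¹ ℚ.- b⁻¹ ∣ ℚ.* (a ℚ.* b) ≡ ℚ.∣ a ℚ.- b ∣
      scaled = trans (cong (ℚ.∣ a⁻¹ ℚ.- b⁻¹ ∣ ℚ.*_) (sym (ℚ.0≤p⇒∣p∣≡p 0≤ab)))
        (trans (sym (ℚ.∣p*q∣≡∣p∣*∣q∣ (a⁻¹ ℚ.- b⁻¹) (a ℚ.* b)))
        (trans (cong ℚ.∣_∣ (trans cross (neg-swap a b)))
               (ℚ.∣-p∣≡∣p∣ (a ℚ.- b))))

recipᴿ : (x : ℝ) → 0ᴿ <ᴿ x → ℝ
recipᴿ x 0<x@(ε , _ , 0<ε , _) = mkℝ (λ n → recip⊔ ε 0<ε (seq x n)) (recip-cauchy x 0<x)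

record ℂ : Set where
  constructor _+i_
  field
    re im : ℝ

open ℂ public

infix 4 _≈ᶜ_

_≈ᶜ_ : ℂ → ℂ → Set
z ≈ᶜ w = (re z ≈ᴿ re w) × (im z ≈ᴿ im w)

ℂ-rawRing : RawRing 0ℓ 0ℓ
ℂ-rawRing = record
  { Carrier = ℂ
  ; _≈_     = _≈ᶜ_
  ; _+_     = λ z w → (re z +ᴿ re w) +i (im z +ᴿ im w)
  ; _*_     = λ z w → (re z *ᴿ re w +ᴿ -ᴿ (im z *ᴿ im w)) +i (re z *ᴿ im w +ᴿ im z *ᴿ re w)
  ; -_      = λ z → (-ᴿ re z) +i (-ᴿ im z)
  ; 0#      = 0ᴿ +i 0ᴿ
  ; 1#      = 1ᴿ +i 0ᴿ
  }

‖_‖² : ℂ → ℝ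
‖ z ‖² = re z *ᴿ re z +ᴿ im z *ᴿ im z

-- |z| < r, for r ≥ 0, in the form |z|² < r².
∣_∣<_ : ℂ → ℚ → Set
∣ z ∣< r = ‖ z ‖² <ᴿ constᴿ (r ℚ.* r)

_#0 : ℂ → Set
z #0 = 0ᴿ <ᴿ ‖ z ‖²

_⁻¹⟨_⟩ : (z : ℂ) → z #0 → ℂ
z ⁻¹⟨ z#0 ⟩ = (re z *ᴿ r) +i (-ᴿ (im z *ᴿ r))
  where r = recipᴿ ‖ z ‖² z#0

infix 4 _⟶_

_⟶_ : (ℕ → ℂ) → ℂ → Set
u ⟶ l = ∀ ε → 0ℚ ℚ.< ε → ∃[ N ] (∀ n → N ℕ.≤ n → ∣ u n - l ∣< ε)
  where
  open RawRing ℂ-rawRing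
  _-_ : ℂ → ℂ → ℂ
  z - w = z + - w

module Finite {c ℓ} (R : RawRing c ℓ) where
  open RawRing R
  open RawSemiringDefs rawSemiring public using (_^_)

  infixl 6 _-_

  _-_ : Carrier → Carrier → Carrier
  a - b = a + - b

  ∑< ∏< : ℕ → (ℕ → Carrier) → Carrier
  ∑< zero    f = 0#
  ∑< (suc n) f = ∑< n f + f n
  ∏< zero    f = 1#
  ∏< (suc n) f = ∏< n f * f n

  -- (a;q)_n
  ⟨_⨾_⟩_ : Carrier → Carrier → ℕ → Carrier
  ⟨ a ⨾ q ⟩ n = ∏< n (λ j → 1# - a * q ^ j)

module _ where
  open RawRing ℂ-rawRing
  open Finite ℂ-rawRing

  private
    SubUnit : ℂ → Set
    SubUnit w = ∃[ N ] (∀ n → N ℕ.≤ n → seq ‖ w ‖² n ℚ.≤ 1ℚ)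

    0≤norm : ∀ z n → 0ℚ ℚ.≤ seq ‖ z ‖² n
    0≤norm z n = ℚ.+-mono-≤ (0≤sq (seq (re z) n)) (0≤sq (seq (im z) n))

    norm-* : ∀ z w n → seq ‖ z * w ‖² n ≡ seq ‖ z ‖² n ℚ.* seq ‖ w ‖² n
    norm-* z w n = two-squares (seq (re z) n) (seq (im z) n) (seq (re w) n) (seq (im w) n)

    ∣1∣≤1 : SubUnit 1#
    ∣1∣≤1 = 0 , λ _ _ → ℚ.≤-refl

    <⇒≤1 : ∀ {z} → ∣ z ∣< 1ℚ → SubUnit z
    <⇒≤1 {z} (ε , N , 0<ε , le) = N , λ n N≤n → ℚ.≤-trans
      (subst (ℚ._≤ seq ‖ z ‖² n ℚ.+ ε) (ℚ.+-identityʳ (seq ‖ z ‖² n))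
        (ℚ.+-monoʳ-≤ (seq ‖ z ‖² n) (ℚ.<⇒≤ 0<ε)))
      (le n N≤n)

    *-<1 : ∀ {z w} → ∣ z ∣< 1ℚ → SubUnit w → ∣ z * w ∣< 1ℚ
    *-<1 {z} {w} (ε , N , 0<ε , le) (M , ≤1) = ε , N ℕ.⊔ M , 0<ε , λ n ≤n →
      ℚ.≤-trans
        (ℚ.+-monoˡ-≤ ε
          (subst₂ ℚ._≤_ (sym (norm-* z w n)) (ℚ.*-identityʳ (seq ‖ z ‖² n))
            (*-monoˡ (seq ‖ z ‖² n) (0≤norm z n) (≤1 n (ℕ.m⊔n≤o⇒n≤o N M ≤n)))))
        (le n (ℕ.m⊔n≤o⇒m≤o N M ≤n))

    ^-≤1 : ∀ {q} → ∣ q ∣< 1ℚ → ∀ j → SubUnit (q ^ j)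
    ^-≤1 ∣q∣<1 zero    = ∣1∣≤1
    ^-≤1 {q} ∣q∣<1 (suc j) = <⇒≤1 {q * q ^ j} (*-<1 {q} {q ^ j} ∣q∣<1 (^-≤1 ∣q∣<1 j))

    1-#0 : ∀ {z} → ∣ z ∣< 1ℚ → (1# - z) #0
    1-#0 {z} (ε , N , 0<ε , le) =
      ½ ℚ.* ε ℚ.* (½ ℚ.* ε) , N , *-pos (½-pos 0<ε) (½-pos 0<ε) , λ n N≤n →
        bound (seq (re z) n) (seq (im z) n) (le n N≤n)
      where
      0≤½ε = ℚ.<⇒≤ (½-pos 0<ε)
      bound : ∀ a b → a ℚ.* a ℚ.+ b ℚ.* b ℚ.+ ε ℚ.≤ 1ℚ →
        0ℚ ℚ.+ ½ ℚ.* ε ℚ.* (½ ℚ.* ε) ℚ.≤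
        (1ℚ ℚ.+ ℚ.- a) ℚ.* (1ℚ ℚ.+ ℚ.- a) ℚ.+ (0ℚ ℚ.+ ℚ.- b) ℚ.* (0ℚ ℚ.+ ℚ.- b)
      bound a b a²+b²+ε≤1 =
        subst (ℚ._≤ (1ℚ ℚ.+ ℚ.- a) ℚ.* (1ℚ ℚ.+ ℚ.- a) ℚ.+ (0ℚ ℚ.+ ℚ.- b) ℚ.* (0ℚ ℚ.+ ℚ.- b))
          (ℚ.+-comm (½ ℚ.* ε ℚ.* (½ ℚ.* ε)) 0ℚ)
          (ℚ.+-mono-≤ (*-mono (ℚ.≤-trans 0≤½ε ½ε≤1-a) 0≤½ε ½ε≤1-a ½ε≤1-a)
                      (0≤sq (0ℚ ℚ.+ ℚ.- b)))
        where
        slack : 0ℚ ℚ.≤ (1ℚ ℚ.- (a ℚ.* a ℚ.+ b ℚ.* b ℚ.+ ε))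
        slack = subst (ℚ._≤ 1ℚ ℚ.- (a ℚ.* a ℚ.+ b ℚ.* b ℚ.+ ε))
          (ℚ.+-inverseʳ (a ℚ.* a ℚ.+ b ℚ.* b ℚ.+ ε))
          (ℚ.+-monoˡ-≤ (ℚ.- (a ℚ.* a ℚ.+ b ℚ.* b ℚ.+ ε)) a²+b²+ε≤1)
        rest = (1ℚ ℚ.- a) ℚ.* (1ℚ ℚ.- a) ℚ.+ b ℚ.* b ℚ.+ (1ℚ ℚ.- (a ℚ.* a ℚ.+ b ℚ.* b ℚ.+ ε))
        ½ε≤1-a : ½ ℚ.* ε ℚ.≤ 1ℚ ℚ.+ ℚ.- a
        ½ε≤1-a = subst₂ ℚ._≤_ (ℚ.+-identityʳ (½ ℚ.* ε))
          (half-gap a b ε)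
          (ℚ.+-monoʳ-≤ (½ ℚ.* ε)
            (subst (ℚ._≤ ½ ℚ.* rest) (ℚ.*-zeroʳ ½)
              (*-monoˡ ½ (ℚ.<⇒≤ (ℚ.positive⁻¹ ½))
                (ℚ.+-mono-≤ (ℚ.+-mono-≤ (0≤sq (1ℚ ℚ.- a)) (0≤sq b)) slack))))

    1#0 : 1# #0
    1#0 = 1ℚ , 0 , ℚ.positive⁻¹ 1ℚ , λ _ _ → ℚ.≤-refl

    *-#0 : ∀ {z w} → z #0 → w #0 → (z * w) #0
    *-#0 {z} {w} (ε , N , 0<ε , ε≤) (δ , M , 0<δ , δ≤) =
      ε ℚ.* δ , N ℕ.⊔ M , *-pos 0<ε 0<δ , λ n ≤n →
        subst₂ ℚ._≤_ (sym (ℚ.+-identityˡ (ε ℚ.* δ))) (sym (norm-* z w n))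
          (*-mono (0≤norm z n) (ℚ.<⇒≤ 0<δ)
            (subst (ℚ._≤ seq ‖ z ‖² n) (ℚ.+-identityˡ ε) (ε≤ n (ℕ.m⊔n≤o⇒m≤o N M ≤n)))
            (subst (ℚ._≤ seq ‖ w ‖² n) (ℚ.+-identityˡ δ) (δ≤ n (ℕ.m⊔n≤o⇒n≤o N M ≤n))))

  abstract
    qfac-#0 : ∀ q → ∣ q ∣< 1ℚ → ∀ n → (⟨ q ⨾ q ⟩ n) #0
    qfac-#0 q ∣q∣<1 zero    = 1#0
    qfac-#0 q ∣q∣<1 (suc n) = *-#0 {⟨ q ⨾ q ⟩ n} {1# - q * q ^ n} (qfac-#0 q ∣q∣<1 n)
      (1-#0 {q * q ^ n} (*-<1 {q} {q ^ n} ∣q∣<1 (^-≤1 ∣q∣<1 n)))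

module Polynomials (q : ℂ) (∣q∣<1 : ∣ q ∣< 1ℚ) where
  open RawRing ℂ-rawRing
  open Finite ℂ-rawRing

  1/⟨q⨾q⟩ : ℕ → ℂ
  1/⟨q⨾q⟩ n = (⟨ q ⨾ q ⟩ n) ⁻¹⟨ qfac-#0 q ∣q∣<1 n ⟩

  -- Only meaningful for k ≤ n.
  [_choose_] : ℕ → ℕ → ℂ
  [ n choose k ] = ⟨ q ⨾ q ⟩ n * (1/⟨q⨾q⟩ k * 1/⟨q⨾q⟩ (n ∸ k))

  P : ℕ → ℂ → ℂ → ℂ
  P n x y = ∏< n (λ j → x - q ^ j * y)

  h : ℕ → ℂ → ℂ → ℂ
  h n x y = ∑< (suc n) (λ k → [ n choose k ] * P k x y)

-- t and s are indeterminates: F n m is the coefficient of tⁿsᵐ in F ∈ ℂ[[t,s]].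
-- Infinite sums and products are limits for coefficientwise convergence in ℂ, so
-- the coefficients of (a;q)_∞ are genuine limits of complex numbers.

ℂ⟦t,s⟧ : Set
ℂ⟦t,s⟧ = ℕ → ℕ → ℂ

private
  module C = RawRing ℂ-rawRing
  module FC = Finite ℂ-rawRing

const : ℂ → ℂ⟦t,s⟧
const c zero zero = c
const c _    _    = C.0#

𝐭 𝐬 : ℂ⟦t,s⟧
𝐭 (suc zero) zero = C.1#
𝐭 _          _    = C.0#
𝐬 zero (suc zero) = C.1#
𝐬 _    _          = C.0#

⟦t,s⟧-rawRing : RawRing 0ℓ 0ℓ
⟦t,s⟧-rawRing = record
  { Carrier = ℂ⟦t,s⟧
  ; _≈_     = λ F G → ∀ n m → F n m ≈ᶜ G n m
  ; _+_     = λ F G n m → F n m C.+ G n m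
  ; _*_     = λ F G n m → FC.∑< (suc n) λ i → FC.∑< (suc m) λ j → F i j C.* G (n ∸ i) (m ∸ j)
  ; -_      = λ F n m → C.- F n m
  ; 0#      = const C.0#
  ; 1#      = const C.1#
  }

infix 4 _⟶ᶠ_

_⟶ᶠ_ : (ℕ → ℂ⟦t,s⟧) → ℂ⟦t,s⟧ → Set
F ⟶ᶠ L = ∀ n m → (λ N → F N n m) ⟶ L n m

module _ where
  open Finite ⟦t,s⟧-rawRing

  -- ∑_{n≥k} F n converges to L.
  HasSum≥ : ℕ → (ℕ → ℂ⟦t,s⟧) → ℂ⟦t,s⟧ → Set
  HasSum≥ k F L = (λ N → ∑< N (λ i → F (k ℕ.+ i))) ⟶ᶠ L

  -- The iterated sum ∑_{n≥k} ∑_{m≥k} F n m converges to L.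
  HasSum≥² : ℕ → (ℕ → ℕ → ℂ⟦t,s⟧) → ℂ⟦t,s⟧ → Set
  HasSum≥² k F L = Σ[ G ∈ (ℕ → ℂ⟦t,s⟧) ] (∀ n → HasSum≥ k (F n) (G n)) × HasSum≥ k G L

  -- (a;q)_∞ = L.
  ⟨_⨾_⟩∞⟶_ : ℂ⟦t,s⟧ → ℂ⟦t,s⟧ → ℂ⟦t,s⟧ → Set
  ⟨ a ⨾ q ⟩∞⟶ L = (λ N → ⟨ a ⨾ q ⟩ N) ⟶ᶠ L

{-# OPTIONS --safe #-}
module Submission where

-- Comparing coefficients of tⁿsᵐ and writing u n = 1/(q;q)ₙ and E z k = (-z)ᵏ q^(k choose 2) u k,
-- the theorem becomes the finite identity
--   ∑ₖ E y k · u (n-k) · u (m-k) · h (n+m-k) = ∑ₖ E x k · (h u)(n-k) · (h u)(m-k).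
-- From (1 - qᵏ) E z k = -z qᵏ⁻¹ E z (k-1), (1 - qⁿ) u n = u (n-1) and the three-term recurrence
--   h (n+1) = (1 + x - y qⁿ) h n - x (1 - qⁿ) h (n-1)
-- both sides F satisfy
--   (1 - qⁿ⁺¹) F (n+1) m = (1 + x - y qⁿ) F n m - x F (n-1) m
--                          + x y qⁿ⁻¹ F (n-1) (m-1) - x qⁿ F n (m-1),
-- and they agree for n = 0. For the infinite product, the coefficients e N k of (xz;q)_N satisfy
-- (1 - qᵏ⁺¹) e N (k+1) = -x (qᵏ - q^N) e N k, hence e N k - E x k is q^N times a bounded sequence.

open import Algebra.Bundles using (CommutativeRing; RawRing)
import Algebra.Properties.AbelianGroup as AbelianGroupProperties
import Algebra.Properties.Monoid.Mult.TCOptimised as MultTC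
import Algebra.Properties.Ring as RingProperties
import Algebra.Properties.Semiring.Exp as Exp
import Algebra.Properties.Semiring.Mult as Mult
import Algebra.Solver.Ring as RingSolver
open import Algebra.Solver.Ring.AlmostCommutativeRing
  using (_-Raw-AlmostCommutative⟶_; fromCommutativeRing)
import Algebra.Solver.Ring.NaturalCoefficients.Default as NatSolver
open import Algebra.Structures using (IsCommutativeRing)
open import Data.Integer.Base as ℤ using (+_; +[1+_])
import Data.Integer.Properties as ℤ
open import Data.Maybe.Base using (Maybe; just; nothing)
open import Data.Nat.Base as ℕ using (ℕ; zero; suc; _∸_; _<_; z<s)
open import Data.Nat.Combinatorics using (_C_; nC1≡n; nCk+nC[k+1]≡[n+1]C[k+1])
import Data.Nat.Properties as ℕ
open import Data.Product.Base using (_×_; _,_; proj₁; proj₂; ∃-syntax; Σ-syntax)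
open import Data.Rational.Base as ℚ using (ℚ; mkℚ; 0ℚ; 1ℚ; ½)
import Data.Rational.Literals as ℚ
import Data.Rational.Properties as ℚ
open import Data.Rational.Solver using (module +-*-Solver)
import Data.Rational.Unnormalised.Base as ℚᵘ
import Data.Rational.Unnormalised.Properties as ℚᵘ
open import Data.Sum.Base as Sum using (_⊎_; inj₁; inj₂)
open import Function.Base using (_∘_)
open import Level using (0ℓ)
import Relation.Binary.Reasoning.Setoid as SetoidReasoning
open import Relation.Binary.PropositionalEquality as ≡ using (_≡_; _≢_)
open import Relation.Nullary.Decidable using (yes; no)
open import Relation.Nullary.Negation using (contradiction)
open import Defs

-- Both sides of the finite identity are sums over k ≤ min n m of terms in k, a = n - k and b = m -
-- k. A recurrence in n comes from 1 - q^(k+a) = (1 - qᵃ) + qᵃ (1 - qᵏ): the first part lowers a,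
-- hence n alone, the second lowers k, hence n and m together. The obstacle is the left side, where
-- lowering a or k leaves `h` at an index one too high for the lowered sum. So `h` is replaced by an
-- arbitrary sequence H, and the three-term recurrence leads back to `h`; the terms with shifted `h`
-- that it creates cancel against those produced by lowering k. Division is kept out of the algebra:
-- it takes place over an arbitrary commutative ring with a given inverse u n of each (q;q)ₙ, which
-- makes every 1 - qⁿ⁺¹ invertible. Coefficient by coefficient all sums are finite, so the only
-- genuine limit is that of (xst;q)_N.

-- The ring solver with integer coefficients, where (m , n) stands for m - n.
module IntegerSolver {c ℓ} (K : CommutativeRing c ℓ) where
  open CommutativeRing K hiding (zero)
  open Mult semiring using () renaming (_×_ to _·_; ×-homo-+ to ·-homo-+; ×1-homo-* to ·1-homo-*)
  open MultTC +-monoid using () renaming (_×_ to _·′_; ×ᵤ≈× to ·≈·′)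
  open RingProperties ring using (-‿distribˡ-*; -‿distribʳ-*; -0#≈0#)
  open AbelianGroupProperties +-abelianGroup using (⁻¹-∙-comm; ⁻¹-involutive)
  open SetoidReasoning setoid

  private
    -- Cancelling the common part keeps numerals small and sends nonnegative integers to plain
    -- multiples of `1#`.
    diff : ℕ → ℕ → ℕ × ℕ
    diff (suc a) (suc b) = diff a b
    diff a       b       = a , b

    Difference : RawRing 0ℓ 0ℓ
    Difference = record
      { Carrier = ℕ × ℕ
      ; _≈_     = _≡_
      ; _+_     = λ (a , b) (c , d) → diff (a ℕ.+ c) (b ℕ.+ d)
      ; _*_     = λ (a , b) (c , d) → diff (a ℕ.* c ℕ.+ b ℕ.* d) (a ℕ.* d ℕ.+ b ℕ.* c)
      ; -_      = λ (a , b) → b , a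
      ; 0#      = 0 , 0
      ; 1#      = 1 , 0
      }

    -- The case split and the optimised multiple make `⟦ 0 , 0 ⟧` and `⟦ 1 , 0 ⟧` reduce to `0#` and
    -- `1#`, so that `:0` and `:1` in a solver call match the literal constants of a goal.
    ⟦_⟧ : ℕ × ℕ → Carrier
    ⟦ a , zero  ⟧ = a ·′ 1#
    ⟦ a , suc b ⟧ = a ·′ 1# + - (suc b ·′ 1#)

    ⟦⟧≈ : ∀ a b → ⟦ a , b ⟧ ≈ a · 1# + - (b · 1#)
    ⟦⟧≈ a zero    = trans (sym (·≈·′ a 1#)) (sym (trans (+-congˡ -0#≈0#) (+-identityʳ _)))
    ⟦⟧≈ a (suc b) = sym (+-cong (·≈·′ a 1#) (-‿cong (·≈·′ (suc b) 1#)))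

    open NatSolver commutativeSemiring using (solve; _:=_; _:+_; _:*_)

    +-rearrange : ∀ a b c d → (a + b) + (c + d) ≈ (a + c) + (b + d)
    +-rearrange = solve 4 (λ a b c d → (a :+ b) :+ (c :+ d) := (a :+ c) :+ (b :+ d)) refl

    ⟦diff⟧ : ∀ a b → ⟦ diff a b ⟧ ≈ a · 1# + - (b · 1#)
    ⟦diff⟧ zero    b       = ⟦⟧≈ zero b
    ⟦diff⟧ (suc a) zero    = ⟦⟧≈ (suc a) zero
    ⟦diff⟧ (suc a) (suc b) = trans (⟦diff⟧ a b) (begin
      a · 1# + - (b · 1#)                    ≈⟨ +-identityˡ _ ⟨
      0# + (a · 1# + - (b · 1#))             ≈⟨ +-congʳ (-‿inverseʳ 1#) ⟨
      (1# + - 1#) + (a · 1# + - (b · 1#))    ≈⟨ +-rearrange _ _ _ _ ⟩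
      (1# + a · 1#) + (- 1# + - (b · 1#))    ≈⟨ +-congˡ (⁻¹-∙-comm _ _) ⟩
      suc a · 1# + - (suc b · 1#)            ∎)

    *-expand : ∀ a b c d → (a + b) * (c + d) ≈ (a * c + b * d) + (a * d + b * c)
    *-expand = solve 4 (λ a b c d →
      (a :+ b) :* (c :+ d) := (a :* c :+ b :* d) :+ (a :* d :+ b :* c)) refl

    -*- : ∀ a b → - a * - b ≈ a * b
    -*- a b = trans (sym (-‿distribˡ-* a (- b)))
      (trans (-‿cong (sym (-‿distribʳ-* a b))) (⁻¹-involutive (a * b)))

    homo-+ : ∀ p q → ⟦ RawRing._+_ Difference p q ⟧ ≈ ⟦ p ⟧ + ⟦ q ⟧
    homo-+ (a , b) (c , d) = begin
      ⟦ diff (a ℕ.+ c) (b ℕ.+ d) ⟧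
        ≈⟨ ⟦diff⟧ (a ℕ.+ c) (b ℕ.+ d) ⟩
      (a ℕ.+ c) · 1# + - ((b ℕ.+ d) · 1#)
        ≈⟨ +-cong (·-homo-+ 1# a c) (trans (-‿cong (·-homo-+ 1# b d)) (sym (⁻¹-∙-comm _ _))) ⟩
      (a · 1# + c · 1#) + (- (b · 1#) + - (d · 1#))
        ≈⟨ +-rearrange _ _ _ _ ⟩
      (a · 1# + - (b · 1#)) + (c · 1# + - (d · 1#))
        ≈⟨ +-cong (⟦⟧≈ a b) (⟦⟧≈ c d) ⟨
      ⟦ a , b ⟧ + ⟦ c , d ⟧ ∎

    homo-·* : ∀ a b c d → (a ℕ.* c ℕ.+ b ℕ.* d) · 1# ≈ (a · 1#) * (c · 1#) + (b · 1#) * (d · 1#)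
    homo-·* a b c d = trans (·-homo-+ 1# (a ℕ.* c) (b ℕ.* d)) (+-cong (·1-homo-* a c) (·1-homo-* b d))

    homo-* : ∀ p q → ⟦ RawRing._*_ Difference p q ⟧ ≈ ⟦ p ⟧ * ⟦ q ⟧
    homo-* (a , b) (c , d) = begin
      ⟦ diff (a ℕ.* c ℕ.+ b ℕ.* d) (a ℕ.* d ℕ.+ b ℕ.* c) ⟧
        ≈⟨ ⟦diff⟧ (a ℕ.* c ℕ.+ b ℕ.* d) (a ℕ.* d ℕ.+ b ℕ.* c) ⟩
      (a ℕ.* c ℕ.+ b ℕ.* d) · 1# + - ((a ℕ.* d ℕ.+ b ℕ.* c) · 1#)
        ≈⟨ +-cong (homo-·* a b c d) (-‿cong (homo-·* a b d c)) ⟩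
      (A * E + B * D) + - (A * D + B * E)
        ≈⟨ +-cong (+-congˡ (-*- B D))
             (trans (+-cong (sym (-‿distribʳ-* A D)) (sym (-‿distribˡ-* B E))) (⁻¹-∙-comm _ _)) ⟨
      (A * E + - B * - D) + (A * - D + - B * E)
        ≈⟨ *-expand A (- B) E (- D) ⟨
      (A + - B) * (E + - D)
        ≈⟨ *-cong (⟦⟧≈ a b) (⟦⟧≈ c d) ⟨
      ⟦ a , b ⟧ * ⟦ c , d ⟧ ∎
      where
      A = a · 1# ; B = b · 1# ; E = c · 1# ; D = d · 1#

    homo-- : ∀ p → ⟦ RawRing.-_ Difference p ⟧ ≈ - ⟦ p ⟧
    homo-- (a , b) = begin
      ⟦ b , a ⟧                     ≈⟨ ⟦⟧≈ b a ⟩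
      b · 1# + - (a · 1#)           ≈⟨ +-comm _ _ ⟩
      - (a · 1#) + b · 1#           ≈⟨ +-congˡ (⁻¹-involutive _) ⟨
      - (a · 1#) + - (- (b · 1#))   ≈⟨ ⁻¹-∙-comm _ _ ⟩
      - (a · 1# + - (b · 1#))       ≈⟨ -‿cong (⟦⟧≈ a b) ⟨
      - ⟦ a , b ⟧                   ∎

    morphism : Difference -Raw-AlmostCommutative⟶ fromCommutativeRing K
    morphism = record
      { ⟦_⟧ = ⟦_⟧ ; +-homo = homo-+ ; *-homo = homo-* ; -‿homo = homo--
      ; 0-homo = refl ; 1-homo = refl }

    add-sub : ∀ a b → a ≈ (a + b) + - b
    add-sub a b = sym (trans (+-assoc a b (- b))
      (trans (+-congˡ (-‿inverseʳ b)) (+-identityʳ a)))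

    equal? : ∀ p q → Maybe (⟦ p ⟧ ≈ ⟦ q ⟧)
    equal? (a , b) (c , d) with a ℕ.+ d ℕ.≟ c ℕ.+ b
    ... | no  _       = nothing
    ... | yes a+d≡c+b = just (begin
      ⟦ a , b ⟧                              ≈⟨ ⟦⟧≈ a b ⟩
      a · 1# + - (b · 1#)                    ≈⟨ +-congʳ (add-sub _ (d · 1#)) ⟩
      (a · 1# + d · 1#) + - (d · 1#) + - (b · 1#)
        ≈⟨ +-congʳ (+-congʳ (trans (sym (·-homo-+ 1# a d))
             (trans (reflexive (≡.cong (_· 1#) a+d≡c+b)) (·-homo-+ 1# c b)))) ⟩
      (c · 1# + b · 1#) + - (d · 1#) + - (b · 1#)
        ≈⟨ solve 4 (λ c b -d -b → (c :+ b) :+ -d :+ -b := (c :+ -d) :+ b :+ -b) refl _ _ _ _ ⟩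
      (c · 1# + - (d · 1#)) + b · 1# + - (b · 1#)
        ≈⟨ add-sub _ _ ⟨
      c · 1# + - (d · 1#)                    ≈⟨ ⟦⟧≈ c d ⟨
      ⟦ c , d ⟧                              ∎)

  open RingSolver Difference (fromCommutativeRing K) morphism equal? public

  :0 :1 : ∀ {n} → Polynomial n
  :0 = con (0 , 0)
  :1 = con (1 , 0)

-- Finite sums, convolutions and diagonal sums under index shifts.

module Sums {c ℓ} (R : RawRing c ℓ)
  (isCommutativeRing : IsCommutativeRing (RawRing._≈_ R) (RawRing._+_ R) (RawRing._*_ R)
                         (RawRing.-_ R) (RawRing.0# R) (RawRing.1# R)) where

  open RawRing R
  open Finite R
  open IsCommutativeRing isCommutativeRing
    using (refl; sym; trans; reflexive; setoid; +-cong; +-congˡ; +-congʳ; +-assoc; +-comm;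
           +-identityˡ; +-identityʳ; *-cong; *-congˡ; *-congʳ; *-assoc; *-identityˡ; *-identityʳ;
           distribˡ; zeroˡ; zeroʳ; -‿cong)
  private
    K : CommutativeRing c ℓ
    K = record { isCommutativeRing = isCommutativeRing }

  open IntegerSolver K
  open SetoidReasoning setoid

  ∑-cong : ∀ {f g} n → (∀ i → f i ≈ g i) → ∑< n f ≈ ∑< n g
  ∑-cong zero    f≈g = refl
  ∑-cong (suc n) f≈g = +-cong (∑-cong n f≈g) (f≈g n)

  ∑-zero : ∀ {f} n → (∀ i → i < n → f i ≈ 0#) → ∑< n f ≈ 0#
  ∑-zero zero    f≈0 = refl
  ∑-zero (suc n) f≈0 = trans
    (+-cong (∑-zero n (λ i i<n → f≈0 i (ℕ.m<n⇒m<1+n i<n))) (f≈0 n ℕ.≤-refl)) (+-identityˡ 0#)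

  ∑-head : ∀ f n → ∑< (suc n) f ≈ f 0 + ∑< n (f ∘ suc)
  ∑-head f zero    = +-comm 0# (f 0)
  ∑-head f (suc n) = trans (+-congʳ (∑-head f n)) (+-assoc _ _ _)

  ∑-single : ∀ {f} n k → k < n → (∀ i → i < n → i ≢ k → f i ≈ 0#) → ∑< n f ≈ f k
  ∑-single {f} (suc n) k k≤n f≈0 with n ℕ.≟ k
  ... | yes ≡.refl = trans
    (+-congʳ (∑-zero n (λ i i<n → f≈0 i (ℕ.m<n⇒m<1+n i<n) (ℕ.<⇒≢ i<n)))) (+-identityˡ (f n))
  ... | no n≢k = trans
    (+-cong (∑-single n k (ℕ.≤∧≢⇒< (ℕ.≤-pred k≤n) (≡.≢-sym n≢k))
              (λ i i<n → f≈0 i (ℕ.m<n⇒m<1+n i<n)))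
            (f≈0 n ℕ.≤-refl n≢k))
    (+-identityʳ (f k))

  ∑-stable : ∀ {f} n N → n ℕ.≤ N → (∀ i → n ℕ.≤ i → f i ≈ 0#) → ∑< N f ≈ ∑< n f
  ∑-stable n zero    ℕ.z≤n f≈0 = refl
  ∑-stable n (suc N) n≤1+N f≈0 with n ℕ.≟ suc N
  ... | yes ≡.refl = refl
  ... | no  n≢1+N  = trans (+-cong (∑-stable n N n≤N f≈0) (f≈0 N n≤N)) (+-identityʳ _)
    where n≤N = ℕ.≤-pred (ℕ.≤∧≢⇒< n≤1+N n≢1+N)

  -- The zero at 0 matches the factor 1 - q⁰ = 0: a recurrence (1 - qⁿ) f n = S g n then covers n =
  -- 0 as well, without a separate boundary case.
  S : (ℕ → Carrier) → ℕ → Carrier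
  S f zero    = 0#
  S f (suc n) = f n

  S-cong : ∀ {f g} n → (∀ i → f i ≈ g i) → S f n ≈ S g n
  S-cong zero    f≈g = refl
  S-cong (suc n) f≈g = f≈g n

  S-*ʳ : ∀ (f w : ℕ → Carrier) n → S f n * w n ≈ S (λ i → f i * w (suc i)) n
  S-*ʳ f w zero    = zeroˡ (w 0)
  S-*ʳ f w (suc n) = refl

  S-*ˡ : ∀ (f w : ℕ → Carrier) n → w n * S f n ≈ S (λ i → w (suc i) * f i) n
  S-*ˡ f w zero    = zeroʳ (w 0)
  S-*ˡ f w (suc n) = refl

  S-+ : ∀ f g n → S f n + S g n ≈ S (λ i → f i + g i) n
  S-+ f g zero    = +-identityˡ 0#
  S-+ f g (suc n) = refl

  -- Passing k and n - k as separate arguments avoids truncated subtraction, so that lowering either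
  -- one is a pattern match.
  convolution : (ℕ → ℕ → Carrier) → ℕ → Carrier
  convolution f zero    = f 0 0
  convolution f (suc n) = f 0 (suc n) + convolution (f ∘ suc) n

  convolution-∑ : ∀ f n → ∑< (suc n) (λ k → f k (n ∸ k)) ≈ convolution f n
  convolution-∑ f zero    = +-identityˡ (f 0 0)
  convolution-∑ f (suc n) = trans (∑-head (λ k → f k (suc n ∸ k)) (suc n))
    (+-congˡ (convolution-∑ (f ∘ suc) n))

  convolution-cong : ∀ {f g} n → (∀ k a → f k a ≈ g k a) → convolution f n ≈ convolution g n
  convolution-cong zero    f≈g = f≈g 0 0
  convolution-cong (suc n) f≈g =
    +-cong (f≈g 0 (suc n)) (convolution-cong n (f≈g ∘ suc))

  +-interchange : ∀ a b c d → (a + b) + (c + d) ≈ (a + c) + (b + d)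
  +-interchange = solve 4 (λ a b c d → (a :+ b) :+ (c :+ d) := (a :+ c) :+ (b :+ d)) refl

  convolution-+ : ∀ f g n →
    convolution (λ k a → f k a + g k a) n ≈ convolution f n + convolution g n
  convolution-+ f g zero    = refl
  convolution-+ f g (suc n) =
    trans (+-congˡ (convolution-+ (f ∘ suc) (g ∘ suc) n)) (+-interchange _ _ _ _)

  -- The weight depends on k + a = n only and is therefore constant along the sum.
  convolution-weight : ∀ w f n → convolution (λ k a → w (k ℕ.+ a) * f k a) n ≈ w n * convolution f n
  convolution-weight w f zero    = refl
  convolution-weight w f (suc n) =
    trans (+-congˡ (convolution-weight (w ∘ suc) (f ∘ suc) n)) (sym (distribˡ _ _ _))

  -- The summand with second index 0, at k = n, drops out, and lowering the second index in the
  -- others leaves the sum for n - 1.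
  convolution-Sʳ : ∀ f n → convolution (λ k → S (f k)) n ≈ S (convolution f) n
  convolution-Sʳ f zero          = refl
  convolution-Sʳ f (suc zero)    = +-identityʳ _
  convolution-Sʳ f (suc (suc n)) = +-congˡ (convolution-Sʳ (f ∘ suc) (suc n))

  convolution-Sˡ : ∀ f n → convolution (λ k a → S (λ i → f i a) k) n ≈ S (convolution f) n
  convolution-Sˡ f zero    = refl
  convolution-Sˡ f (suc n) = +-identityˡ _

  S₁ S₂ : (ℕ → ℕ → Carrier) → ℕ → ℕ → Carrier
  S₁ F n m = S (λ i → F i m) n
  S₂ F n m = S (F n) m

  -- ∑ₖ f k (n - k) (m - k), over 0 ≤ k ≤ min n m.
  diagonal : (ℕ → ℕ → ℕ → Carrier) → ℕ → ℕ → Carrier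
  diagonal f zero    m       = f 0 0 m
  diagonal f (suc n) zero    = f 0 (suc n) 0
  diagonal f (suc n) (suc m) = f 0 (suc n) (suc m) + diagonal (f ∘ suc) n m

  diagonal-0 : ∀ f n → diagonal f n 0 ≈ f 0 n 0
  diagonal-0 f zero    = refl
  diagonal-0 f (suc n) = refl

  diagonal-cong : ∀ {f g} n m → (∀ k a b → f k a b ≈ g k a b) → diagonal f n m ≈ diagonal g n m
  diagonal-cong zero    m       f≈g = f≈g 0 0 m
  diagonal-cong (suc n) zero    f≈g = f≈g 0 (suc n) 0
  diagonal-cong (suc n) (suc m) f≈g =
    +-cong (f≈g 0 (suc n) (suc m)) (diagonal-cong n m (f≈g ∘ suc))

  diagonal-+ : ∀ f g n m →
    diagonal (λ k a b → f k a b + g k a b) n m ≈ diagonal f n m + diagonal g n m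
  diagonal-+ f g zero    m       = refl
  diagonal-+ f g (suc n) zero    = refl
  diagonal-+ f g (suc n) (suc m) =
    trans (+-congˡ (diagonal-+ (f ∘ suc) (g ∘ suc) n m)) (+-interchange _ _ _ _)

  diagonal-weight : ∀ w f n m →
    diagonal (λ k a b → w (k ℕ.+ a) * f k a b) n m ≈ w n * diagonal f n m
  diagonal-weight w f zero    m       = refl
  diagonal-weight w f (suc n) zero    = refl
  diagonal-weight w f (suc n) (suc m) =
    trans (+-congˡ (diagonal-weight (w ∘ suc) (f ∘ suc) n m)) (sym (distribˡ _ _ _))

  -- For n ≤ m the summand k = n vanishes; otherwise the range k ≤ m is already the one for n - 1
  -- and m.
  diagonal-S₁ : ∀ f n m → diagonal (λ k → S₁ (f k)) n m ≈ S₁ (diagonal f) n m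
  diagonal-S₁ f zero          m       = refl
  diagonal-S₁ f (suc n)       zero    = sym (diagonal-0 f n)
  diagonal-S₁ f (suc zero)    (suc m) = +-identityʳ _
  diagonal-S₁ f (suc (suc n)) (suc m) = +-congˡ (diagonal-S₁ (f ∘ suc) (suc n) m)

  diagonal-S₂ : ∀ f n m → diagonal (λ k → S₂ (f k)) n m ≈ S₂ (diagonal f) n m
  diagonal-S₂ f zero    zero          = refl
  diagonal-S₂ f (suc n) zero          = refl
  diagonal-S₂ f zero    (suc m)       = refl
  diagonal-S₂ f (suc n) (suc zero)    = trans
    (+-congˡ (diagonal-0 (λ k → S₂ (f (suc k))) n)) (+-identityʳ _)
  diagonal-S₂ f (suc n) (suc (suc m)) = +-congˡ (diagonal-S₂ (f ∘ suc) n (suc m))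

  -- The summand k = 0 vanishes, and k = i + 1 has n - k = (n - 1) - i and m - k = (m - 1) - i:
  -- lowering k lowers both arguments at once.
  diagonal-S₁₂ : ∀ f n m →
    diagonal (λ k a b → S (λ i → f i a b) k) n m ≈ S₁ (S₂ (diagonal f)) n m
  diagonal-S₁₂ f zero    m       = refl
  diagonal-S₁₂ f (suc n) zero    = refl
  diagonal-S₁₂ f (suc n) (suc m) = +-identityˡ _

  S₁-cong : ∀ {F G} n m → (∀ i j → F i j ≈ G i j) → S₁ F n m ≈ S₁ G n m
  S₁-cong n m F≈G = S-cong n (λ i → F≈G i m)

  S₂-cong : ∀ {F G} n m → (∀ i j → F i j ≈ G i j) → S₂ F n m ≈ S₂ G n m
  S₂-cong n m F≈G = S-cong m (F≈G n)

-- Monomials, and power series in the product ts.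

module Series {c ℓ} (R : RawRing c ℓ)
  (isCommutativeRing : IsCommutativeRing (RawRing._≈_ R) (RawRing._+_ R) (RawRing._*_ R)
                         (RawRing.-_ R) (RawRing.0# R) (RawRing.1# R)) where

  open RawRing R
  open Finite R
  open IsCommutativeRing isCommutativeRing
    using (refl; sym; trans; reflexive; setoid; +-cong; +-congˡ; +-congʳ; +-assoc; +-comm;
           +-identityˡ; +-identityʳ; *-cong; *-congˡ; *-congʳ; *-assoc; *-identityˡ; *-identityʳ;
           distribˡ; zeroˡ; zeroʳ; -‿cong)
  private
    K : CommutativeRing c ℓ
    K = record { isCommutativeRing = isCommutativeRing }

  open IntegerSolver K
  open Sums R isCommutativeRing
  open SetoidReasoning setoid

  infixl 7 _⊛_

  -- The multiplication of `⟦t,s⟧-rawRing` over an abstract coefficient ring, so that reasoning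
  -- about it never meets the Cauchy sequences behind `ℂ`.
  _⊛_ : (ℕ → ℕ → Carrier) → (ℕ → ℕ → Carrier) → ℕ → ℕ → Carrier
  (F ⊛ G) n m = ∑< (suc n) λ i → ∑< (suc m) λ j → F i j * G (n ∸ i) (m ∸ j)

  -- F = c tᵃsᵇ.
  record Monomial (a b : ℕ) (c : Carrier) (F : ℕ → ℕ → Carrier) : Set ℓ where
    field
      coefficient : F a b ≈ c
      off₁        : ∀ i j → i ≢ a → F i j ≈ 0#
      off₂        : ∀ i j → j ≢ b → F i j ≈ 0#

  open Monomial public

  monomial-cong : ∀ {a a′ b b′ c c′ F} → Monomial a b c F →
    a ≡ a′ → b ≡ b′ → c ≈ c′ → Monomial a′ b′ c′ F
  monomial-cong M ≡.refl ≡.refl c≈c′ = record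
    { coefficient = trans (coefficient M) c≈c′ ; off₁ = off₁ M ; off₂ = off₂ M }

  private
    i≢n⇒ : ∀ {a n i} → i < suc (a ℕ.+ n) → i ≢ n → a ℕ.+ n ∸ i ≢ a
    i≢n⇒ {a} {n} {i} i≤a+n i≢n eq = i≢n (ℕ.+-cancelˡ-≡ a i n
      (≡.trans (≡.cong (ℕ._+ i) (≡.sym eq)) (ℕ.m∸n+n≡m (ℕ.≤-pred i≤a+n))))

    n<a⇒ : ∀ {a n} i → n < a → n ∸ i ≢ a
    n<a⇒ {a} {n} i n<a = ℕ.<⇒≢ (ℕ.≤-<-trans (ℕ.m∸n≤m n i) n<a)

    *-vanishʳ : ∀ a {b} → b ≈ 0# → a * b ≈ 0#
    *-vanishʳ a b≈0 = trans (*-congˡ b≈0) (zeroʳ a)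

    *-vanishˡ : ∀ {a} b → a ≈ 0# → a * b ≈ 0#
    *-vanishˡ b a≈0 = trans (*-congʳ a≈0) (zeroˡ b)

  ⊛-monomial : ∀ {a b c G} F → Monomial a b c G → ∀ n m →
    (F ⊛ G) (a ℕ.+ n) (b ℕ.+ m) ≈ F n m * c
  ⊛-monomial {a} {b} {c} {G} F M n m = begin
    (F ⊛ G) (a ℕ.+ n) (b ℕ.+ m)
      ≈⟨ ∑-single (suc (a ℕ.+ n)) n (ℕ.s≤s (ℕ.m≤n+m n a)) (λ i i≤ i≢n →
           ∑-zero (suc (b ℕ.+ m)) λ j _ → *-vanishʳ _ (off₁ M _ _ (i≢n⇒ i≤ i≢n))) ⟩
    ∑< (suc (b ℕ.+ m)) (λ j → F n j * G (a ℕ.+ n ∸ n) (b ℕ.+ m ∸ j))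
      ≈⟨ ∑-single (suc (b ℕ.+ m)) m (ℕ.s≤s (ℕ.m≤n+m m b)) (λ j j≤ j≢m →
           *-vanishʳ _ (off₂ M _ _ (i≢n⇒ j≤ j≢m))) ⟩
    F n m * G (a ℕ.+ n ∸ n) (b ℕ.+ m ∸ m)
      ≈⟨ *-congˡ (trans (reflexive (≡.cong₂ G (ℕ.m+n∸n≡m a n) (ℕ.m+n∸n≡m b m))) (coefficient M)) ⟩
    F n m * c ∎

  ⊛-monomial-<₁ : ∀ {a b c G} F → Monomial a b c G → ∀ {n} m → n < a → (F ⊛ G) n m ≈ 0#
  ⊛-monomial-<₁ F M {n} m n<a = ∑-zero (suc n) λ i _ → ∑-zero (suc m) λ j _ →
    *-vanishʳ _ (off₁ M _ _ (n<a⇒ i n<a))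

  ⊛-monomial-<₂ : ∀ {a b c G} F → Monomial a b c G → ∀ n {m} → m < b → (F ⊛ G) n m ≈ 0#
  ⊛-monomial-<₂ F M n {m} m<b = ∑-zero (suc n) λ i _ → ∑-zero (suc m) λ j _ →
    *-vanishʳ _ (off₂ M _ _ (n<a⇒ j m<b))

  constant-⊛ : ∀ {c F} → Monomial 0 0 c F → ∀ G n m → (F ⊛ G) n m ≈ c * G n m
  constant-⊛ M G n m = trans
    (∑-single (suc n) 0 z<s (λ i _ i≢0 → ∑-zero (suc m) λ j _ → *-vanishˡ _ (off₁ M _ _ i≢0)))
    (trans (∑-single (suc m) 0 z<s (λ j _ j≢0 → *-vanishˡ _ (off₂ M _ _ j≢0)))
           (*-congʳ (coefficient M)))

  -- If an index lies below the degree of `G`, no term contributes; otherwise the indices are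
  -- `a′ + n` and `b′ + m`, the coefficient is `F n m * c′`, and the question is one about `F`.
  Monomial-⊛ : ∀ {a b c F a′ b′ c′ G} → Monomial a b c F → Monomial a′ b′ c′ G →
    Monomial (a′ ℕ.+ a) (b′ ℕ.+ b) (c * c′) (F ⊛ G)
  Monomial-⊛ {a} {b} {c} {F} {a′} {b′} {c′} {G} M M′ = record
    { coefficient = trans (⊛-monomial F M′ a b) (*-congʳ (coefficient M))
    ; off₁ = λ i j i≢ → vanish i j λ n m n+ m+ → off₁ M n m (λ n≡a → i≢ (≡.trans n+ (≡.cong (a′ ℕ.+_) n≡a)))
    ; off₂ = λ i j j≢ → vanish i j λ n m n+ m+ → off₂ M n m (λ m≡b → j≢ (≡.trans m+ (≡.cong (b′ ℕ.+_) m≡b)))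
    }
    where
    vanish : ∀ i j → (∀ n m → i ≡ a′ ℕ.+ n → j ≡ b′ ℕ.+ m → F n m ≈ 0#) → (F ⊛ G) i j ≈ 0#
    vanish i j F≈0 with ℕ.<-≤-connex i a′ | ℕ.<-≤-connex j b′
    ... | inj₁ i<a′ | _         = ⊛-monomial-<₁ F M′ j i<a′
    ... | inj₂ _    | inj₁ j<b′ = ⊛-monomial-<₂ F M′ i j<b′
    ... | inj₂ a′≤i | inj₂ b′≤j with ℕ.m≤n⇒∃[o]m+o≡n a′≤i | ℕ.m≤n⇒∃[o]m+o≡n b′≤j
    ...   | n , ≡.refl | m , ≡.refl = trans (⊛-monomial F M′ n m) (*-vanishˡ c′ (F≈0 n m ≡.refl ≡.refl))

  ∑-sub : ∀ f g n → ∑< n (λ i → f i - g i) ≈ ∑< n f - ∑< n g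
  ∑-sub f g zero    = solve 0 (:0 := :0 :- :0) refl
  ∑-sub f g (suc n) = trans (+-congʳ (∑-sub f g n))
    (solve 4 (λ a b c d → (a :- b) :+ (c :- d) := (a :+ c) :- (b :+ d)) refl _ _ _ _)

  ⊛-sub : ∀ F G H n m → (F ⊛ (λ i j → G i j - H i j)) n m ≈ (F ⊛ G) n m - (F ⊛ H) n m
  ⊛-sub F G H n m = trans
    (∑-cong (suc n) (λ i → trans
      (∑-cong (suc m) (λ j → solve 3 (λ f g h → f :* (g :- h) := f :* g :- f :* h) refl _ _ _))
      (∑-sub _ _ (suc m))))
    (∑-sub _ _ (suc n))

  ⊛-1-ts : ∀ F {c 𝟙 G} → Monomial 0 0 1# 𝟙 → Monomial 1 1 c G → ∀ n m →
    (F ⊛ (λ i j → 𝟙 i j - G i j)) n m ≈ F n m - S₁ (S₂ F) n m * c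
  ⊛-1-ts F {c} {𝟙} {G} M M′ n m = trans (⊛-sub F 𝟙 G n m)
    (+-cong (trans (⊛-monomial F M n m) (*-identityʳ _)) (-‿cong (shifted n m)))
    where
    shifted : ∀ n m → (F ⊛ G) n m ≈ S₁ (S₂ F) n m * c
    shifted zero    m       = trans (⊛-monomial-<₁ F M′ m z<s) (sym (zeroˡ c))
    shifted (suc n) zero    = trans (⊛-monomial-<₂ F M′ (suc n) z<s) (sym (zeroˡ c))
    shifted (suc n) (suc m) = ⊛-monomial F M′ n m

  -- (ts)ᵏ F
  shift : ℕ → (ℕ → ℕ → Carrier) → ℕ → ℕ → Carrier
  shift zero    F n       m       = F n m
  shift (suc k) F (suc n) (suc m) = shift k F n m
  shift (suc k) F _       _       = 0#

  shift-+ : ∀ k F n m → shift k F (k ℕ.+ n) (k ℕ.+ m) ≈ F n m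
  shift-+ zero    F n m = refl
  shift-+ (suc k) F n m = shift-+ k F n m

  shift-<₁ : ∀ k F n m → n < k → shift k F n m ≈ 0#
  shift-<₁ (suc k) F zero    m       n<k = refl
  shift-<₁ (suc k) F (suc n) zero    n<k = refl
  shift-<₁ (suc k) F (suc n) (suc m) n<k = shift-<₁ k F n m (ℕ.≤-pred n<k)

  shift-<₂ : ∀ k F n m → m < k → shift k F n m ≈ 0#
  shift-<₂ (suc k) F zero    m       m<k = refl
  shift-<₂ (suc k) F (suc n) zero    m<k = refl
  shift-<₂ (suc k) F (suc n) (suc m) m<k = shift-<₂ k F n m (ℕ.≤-pred m<k)

  *-shift : ∀ c k F n m → c * shift k F n m ≈ shift k (λ i j → c * F i j) n m
  *-shift c zero    F n       m       = refl
  *-shift c (suc k) F zero    m       = zeroʳ c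
  *-shift c (suc k) F (suc n) zero    = zeroʳ c
  *-shift c (suc k) F (suc n) (suc m) = *-shift c k F n m

  -- Stopping at k = n loses nothing, since (ts)ᵏ F has no coefficient at n < k; the summands with m
  -- < k ≤ n vanish as well.
  ∑-shift : ∀ F n m → ∑< (suc n) (λ k → shift k (F k) n m) ≈ diagonal F n m
  ∑-shift F zero    m       = +-identityˡ _
  ∑-shift F (suc n) zero    = trans (∑-head _ (suc n))
    (trans (+-congˡ (∑-zero (suc n) λ _ _ → refl)) (+-identityʳ _))
  ∑-shift F (suc n) (suc m) = trans (∑-head _ (suc n)) (+-congˡ (∑-shift (F ∘ suc) n m))

  -- Different exponents give different monomials, so at most one summand, at (n - k , m - k), meets
  -- the coefficient at (n , m). The cutoffs `suc n` and `suc m` serve for every `k`.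
  monomial-sum : ∀ k {F : ℕ → ℕ → ℕ → ℕ → Carrier} {c : ℕ → ℕ → Carrier} →
    (∀ n m → Monomial n m (c n m) (F n m)) → ∀ n m →
    ∑< (suc n) (λ i → ∑< (suc m) (λ j → F (k ℕ.+ i) (k ℕ.+ j) n m))
      ≈ shift k (λ i j → c (k ℕ.+ i) (k ℕ.+ j)) n m
  monomial-sum k {F} {c} M n m with ℕ.<-≤-connex n k | ℕ.<-≤-connex m k
  ... | inj₁ n<k | _ = trans
    (∑-zero (suc n) λ i _ → ∑-zero (suc m) λ j _ → off₁ (M (k ℕ.+ i) (k ℕ.+ j)) n m
      (ℕ.<⇒≢ (ℕ.<-≤-trans n<k (ℕ.m≤m+n k i))))
    (sym (shift-<₁ k _ n m n<k))
  ... | inj₂ _ | inj₁ m<k = trans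
    (∑-zero (suc n) λ i _ → ∑-zero (suc m) λ j _ → off₂ (M (k ℕ.+ i) (k ℕ.+ j)) n m
      (ℕ.<⇒≢ (ℕ.<-≤-trans m<k (ℕ.m≤m+n k j))))
    (sym (shift-<₂ k _ n m m<k))
  ... | inj₂ k≤n | inj₂ k≤m with ℕ.m≤n⇒∃[o]m+o≡n k≤n | ℕ.m≤n⇒∃[o]m+o≡n k≤m
  ...   | n′ , ≡.refl | m′ , ≡.refl = begin
    ∑< (suc n) (λ i → ∑< (suc m) (λ j → F (k ℕ.+ i) (k ℕ.+ j) n m))
      ≈⟨ ∑-single (suc n) n′ (ℕ.s≤s (ℕ.m≤n+m n′ k)) (λ i _ i≢n′ → ∑-zero (suc m) λ j _ →
           off₁ (M (k ℕ.+ i) (k ℕ.+ j)) n m (i≢n′ ∘ ≡.sym ∘ ℕ.+-cancelˡ-≡ k n′ i)) ⟩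
    ∑< (suc m) (λ j → F n (k ℕ.+ j) n m)
      ≈⟨ ∑-single (suc m) m′ (ℕ.s≤s (ℕ.m≤n+m m′ k)) (λ j _ j≢m′ →
           off₂ (M n (k ℕ.+ j)) n m (j≢m′ ∘ ≡.sym ∘ ℕ.+-cancelˡ-≡ k m′ j)) ⟩
    F n m n m
      ≈⟨ coefficient (M n m) ⟩
    c n m
      ≈⟨ shift-+ k _ n′ m′ ⟨
    shift k (λ i j → c (k ℕ.+ i) (k ℕ.+ j)) n m ∎

  -- ∑ₖ e k (ts)ᵏ
  Δ : (ℕ → Carrier) → ℕ → ℕ → Carrier
  Δ e zero    zero    = e 0
  Δ e (suc n) (suc m) = Δ (e ∘ suc) n m
  Δ e _       _       = 0#

  -- The position `k` does not depend on `e`, so a single case distinction transfers identities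
  -- between several sequences and bounds along a whole family of them.
  Δ-entry : ∀ n m → (∃[ k ] (∀ e → Δ e n m ≡ e k)) ⊎ (∀ e → Δ e n m ≡ 0#)
  Δ-entry zero    zero    = inj₁ (0 , λ _ → ≡.refl)
  Δ-entry zero    (suc m) = inj₂ λ _ → ≡.refl
  Δ-entry (suc n) zero    = inj₂ λ _ → ≡.refl
  Δ-entry (suc n) (suc m) with Δ-entry n m
  ... | inj₁ (k , eq) = inj₁ (suc k , λ e → eq (e ∘ suc))
  ... | inj₂ eq       = inj₂ λ e → eq (e ∘ suc)

  Δ-row : ∀ e (g : ℕ → Carrier) m → ∑< (suc m) (λ j → Δ e 0 j * g (m ∸ j)) ≈ e 0 * g m
  Δ-row e g m = ∑-single (suc m) 0 z<s λ where
    zero    _ 0≢0 → contradiction ≡.refl 0≢0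
    (suc j) _ _   → zeroˡ _

  -- Row 0 of `Δ e` holds only `e 0`, and removing the first row and column leaves `Δ (e ∘ suc)`;
  -- this is the recursion of `diagonal`.
  Δ-⊛ : ∀ e G n m → (Δ e ⊛ G) n m ≈ diagonal (λ k a b → e k * G a b) n m
  Δ-⊛ e G zero    m       = trans (+-identityˡ _) (Δ-row e (G 0) m)
  Δ-⊛ e G (suc n) zero    = trans (∑-head _ (suc n)) (trans
    (+-cong (Δ-row e (G (suc n)) 0)
      (∑-zero (suc n) λ _ _ → trans (+-identityˡ _) (zeroˡ _)))
    (+-identityʳ _))
  Δ-⊛ e G (suc n) (suc m) = trans (∑-head _ (suc n)) (+-cong (Δ-row e (G (suc n)) (suc m))
    (trans
      (∑-cong (suc n) (λ i → trans (∑-head _ (suc m)) (trans (+-congʳ (zeroˡ _)) (+-identityˡ _))))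
      (Δ-⊛ (e ∘ suc) G n m)))

  Δ-sub : ∀ e f c n m → Δ (λ k → e k - f k * c) n m ≈ Δ e n m - Δ f n m * c
  Δ-sub e f c n m with Δ-entry n m
  ... | inj₁ (k , eq) = trans (reflexive (eq _))
    (sym (+-cong (reflexive (eq e)) (-‿cong (*-congʳ (reflexive (eq f))))))
  ... | inj₂ eq = trans (reflexive (eq _)) (trans (solve 1 (λ c → :0 := :0 :- :0 :* c) refl c)
    (sym (+-cong (reflexive (eq e)) (-‿cong (*-congʳ (reflexive (eq f)))))))

  -- The effect on coefficients of multiplying a series in ts by 1 - c ts.
  Δ-1-ts : ∀ e c n m → Δ (λ k → e k - S e k * c) n m ≈ Δ e n m - S₁ (S₂ (Δ e)) n m * c
  Δ-1-ts e c zero    zero    = refl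
  Δ-1-ts e c zero    (suc m) = solve 1 (λ c → :0 := :0 :- :0 :* c) refl c
  Δ-1-ts e c (suc n) zero    = solve 1 (λ c → :0 := :0 :- :0 :* c) refl c
  Δ-1-ts e c (suc n) (suc m) = Δ-sub (e ∘ suc) e c n m

  monomial-neg : ∀ {a b c F} → Monomial a b c F → Monomial a b (- c) (λ i j → - F i j)
  monomial-neg M = record
    { coefficient = -‿cong (coefficient M)
    ; off₁        = λ i j i≢a → trans (-‿cong (off₁ M i j i≢a)) -0≈0
    ; off₂        = λ i j j≢b → trans (-‿cong (off₂ M i j j≢b)) -0≈0
    }
    where
    -0≈0 : - 0# ≈ 0#
    -0≈0 = solve 0 (:- :0 := :0) refl

  1^n≈1 : ∀ n → 1# ^ n ≈ 1#
  1^n≈1 zero    = refl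
  1^n≈1 (suc n) = trans (*-identityˡ _) (1^n≈1 n)

-- The coefficient identity over a commutative ring in which each (q;q)ₙ is invertible.

module Linearization {c ℓ} (R : RawRing c ℓ)
  (isCommutativeRing : IsCommutativeRing (RawRing._≈_ R) (RawRing._+_ R) (RawRing._*_ R)
                         (RawRing.-_ R) (RawRing.0# R) (RawRing.1# R))
  (q x y : RawRing.Carrier R) (u P h : ℕ → RawRing.Carrier R)
  (u-inverse : ∀ n → RawRing._≈_ R
    (RawRing._*_ R (Finite.⟨_⨾_⟩_ R q q n) (u n)) (RawRing.1# R))
  (P-0 : RawRing._≈_ R (P 0) (RawRing.1# R))
  (P-suc : ∀ k → RawRing._≈_ R (P (suc k))
    (RawRing._*_ R (P k) (Finite._-_ R x (RawRing._*_ R (Finite._^_ R q k) y))))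
  (h-sum : ∀ n → RawRing._≈_ R (h n) (Finite.∑< R (suc n) λ k →
    RawRing._*_ R (RawRing._*_ R (Finite.⟨_⨾_⟩_ R q q n) (RawRing._*_ R (u k) (u (n ∸ k)))) (P k))) where

  open RawRing R
  open Finite R
  open IsCommutativeRing isCommutativeRing
    using (refl; sym; trans; reflexive; setoid; +-cong; +-congˡ; +-congʳ; +-assoc; +-comm;
           +-identityˡ; +-identityʳ; *-cong; *-congˡ; *-congʳ; *-assoc; *-identityˡ; *-identityʳ;
           distribˡ; zeroˡ; zeroʳ; -‿cong)
  private
    K : CommutativeRing c ℓ
    K = record { isCommutativeRing = isCommutativeRing }

  open IntegerSolver K
  open Sums R isCommutativeRing
  open Series R isCommutativeRing
  open SetoidReasoning setoid

  -- `α n` is h n / (q;q)ₙ: this division turns the q-binomial sum into a plain convolution of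
  -- Pₖ/(q;q)ₖ with 1/(q;q)ₐ.
  α p : ℕ → Carrier
  p k = u k * P k
  α   = convolution (λ k a → p k * u a)

  -- (-z)ᵏ q^{k(k-1)/2} / (q;q)ₖ
  G E : Carrier → ℕ → Carrier
  G z zero    = 1#
  G z (suc k) = G z k * (- z * q ^ k)
  E z k = G z k * u k

  q^-+ : ∀ k a → q ^ (k ℕ.+ a) ≈ q ^ k * q ^ a
  q^-+ = Exp.^-homo-* (CommutativeRing.semiring K) q

  u-0 : u 0 ≈ 1#
  u-0 = trans (sym (*-identityˡ (u 0))) (u-inverse 0)

  u-suc : ∀ n → (1# - q ^ suc n) * u (suc n) ≈ u n
  u-suc n = begin
    (1# - q ^ suc n) * u (suc n)
      ≈⟨ *-identityˡ _ ⟨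
    1# * ((1# - q ^ suc n) * u (suc n))
      ≈⟨ *-congʳ (u-inverse n) ⟨
    (⟨ q ⨾ q ⟩ n * u n) * ((1# - q ^ suc n) * u (suc n))
      ≈⟨ solve 4 (λ f v g w → (f :* v) :* (g :* w) := v :* (f :* g :* w)) refl _ _ _ _ ⟩
    u n * (⟨ q ⨾ q ⟩ suc n * u (suc n))
      ≈⟨ *-congˡ (u-inverse (suc n)) ⟩
    u n * 1#
      ≈⟨ *-identityʳ (u n) ⟩
    u n ∎

  1-1* : ∀ a → (1# - 1#) * a ≈ 0#
  1-1* = solve 1 (λ a → (:1 :- :1) :* a := :0) refl

  u-rec : ∀ n → (1# - q ^ n) * u n ≈ S u n
  u-rec zero    = 1-1* (u 0)
  u-rec (suc n) = u-suc n

  -- 1 - qⁿ⁺¹ is a factor of the invertible (q;q)ₙ₊₁, so its inverse is (q;q)ₙ u (n+1).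
  cancel : ∀ n {a b} → (1# - q ^ suc n) * a ≈ (1# - q ^ suc n) * b → a ≈ b
  cancel n {a} {b} eq = begin
    a                                   ≈⟨ lemma a ⟨
    w * ((1# - q ^ suc n) * a)          ≈⟨ *-congˡ eq ⟩
    w * ((1# - q ^ suc n) * b)          ≈⟨ lemma b ⟩
    b                                   ∎
    where
    w = ⟨ q ⨾ q ⟩ n * u (suc n)
    lemma : ∀ a → w * ((1# - q ^ suc n) * a) ≈ a
    lemma a = begin
      w * ((1# - q ^ suc n) * a)
        ≈⟨ solve 4 (λ f v g a → (f :* v) :* (g :* a) := (f :* g :* v) :* a) refl _ _ _ _ ⟩
      (⟨ q ⨾ q ⟩ suc n * u (suc n)) * a  ≈⟨ *-congʳ (u-inverse (suc n)) ⟩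
      1# * a                             ≈⟨ *-identityˡ a ⟩
      a                                  ∎

  E-0 : ∀ z → E z 0 ≈ 1#
  E-0 z = trans (*-identityˡ (u 0)) u-0

  E-rec : ∀ z k → (1# - q ^ k) * E z k ≈ S (λ i → (- z * q ^ i) * E z i) k
  E-rec z zero    = 1-1* _
  E-rec z (suc k) = begin
    (1# - q ^ suc k) * (G z k * (- z * q ^ k) * u (suc k))
      ≈⟨ solve 4 (λ d g w v → d :* (g :* w :* v) := g :* w :* (d :* v)) refl _ _ _ _ ⟩
    G z k * (- z * q ^ k) * ((1# - q ^ suc k) * u (suc k))
      ≈⟨ *-congˡ (u-suc k) ⟩
    G z k * (- z * q ^ k) * u k
      ≈⟨ solve 3 (λ g w v → g :* w :* v := w :* (g :* v)) refl _ _ _ ⟩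
    (- z * q ^ k) * E z k ∎

  p-rec : ∀ k → (1# - q ^ k) * p k ≈ S (λ i → (x - q ^ i * y) * p i) k
  p-rec zero    = 1-1* _
  p-rec (suc k) = begin
    (1# - q ^ suc k) * (u (suc k) * P (suc k))
      ≈⟨ *-congˡ (*-congˡ (P-suc k)) ⟩
    (1# - q ^ suc k) * (u (suc k) * (P k * (x - q ^ k * y)))
      ≈⟨ solve 4 (λ d v r w → d :* (v :* (r :* w)) := w :* ((d :* v) :* r)) refl _ _ _ _ ⟩
    (x - q ^ k * y) * ((1# - q ^ suc k) * u (suc k) * P k)
      ≈⟨ *-congˡ (*-congʳ (u-suc k)) ⟩
    (x - q ^ k * y) * p k ∎

  -- The right-hand side of the three-term recurrence of `h` divided by (q;q)ₙ, which absorbs the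
  -- factor 1 - qⁿ in front of h (n-1).
  A : ℕ → Carrier
  A n = (1# + x - y * q ^ n) * α n - x * S α n

  -- By 1 - q^(k+a) = (1 - qᵏ) + qᵏ (1 - qᵃ), where the first part lowers the index of `p` and the
  -- second that of `u`, the convolutions of `f₁` and `f₂` at n - 1 remain. Their sum has to be
  -- expressed through `α`.
  α-rec : ∀ n → (1# - q ^ n) * α n ≈ S A n
  α-rec n = begin
    (1# - q ^ n) * α n
      ≈⟨ convolution-weight (λ n → 1# - q ^ n) (λ k a → p k * u a) n ⟨
    convolution (λ k a → (1# - q ^ (k ℕ.+ a)) * (p k * u a)) n
      ≈⟨ convolution-cong n step₁ ⟩
    convolution (λ k a → S (λ i → f₁ i a) k + S (f₂ k) a) n
      ≈⟨ convolution-+ (λ k a → S (λ i → f₁ i a) k) (λ k → S (f₂ k)) n ⟩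
    convolution (λ k a → S (λ i → f₁ i a) k) n + convolution (λ k → S (f₂ k)) n
      ≈⟨ +-cong (convolution-Sˡ f₁ n) (convolution-Sʳ f₂ n) ⟩
    S (convolution f₁) n + S (convolution f₂) n
      ≈⟨ S-+ _ _ n ⟩
    S (λ i → convolution f₁ i + convolution f₂ i) n
      ≈⟨ S-cong n (λ i → trans (sym (convolution-+ f₁ f₂ i)) (sum i)) ⟩
    S A n ∎
    where
    f₁ f₂ : ℕ → ℕ → Carrier
    f₁ k a = (x - q ^ k * y) * p k * u a
    f₂ k a = q ^ k * p k * u a

    step₁ : ∀ k a → (1# - q ^ (k ℕ.+ a)) * (p k * u a) ≈ S (λ i → f₁ i a) k + S (f₂ k) a
    step₁ k a = begin
      (1# - q ^ (k ℕ.+ a)) * (p k * u a)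
        ≈⟨ *-congʳ (+-congˡ (-‿cong (q^-+ k a))) ⟩
      (1# - q ^ k * q ^ a) * (p k * u a)
        ≈⟨ solve 4 (λ s t p u → (:1 :- s :* t) :* (p :* u)
             := (:1 :- s) :* p :* u :+ s :* p :* ((:1 :- t) :* u)) refl _ _ _ _ ⟩
      (1# - q ^ k) * p k * u a + q ^ k * p k * ((1# - q ^ a) * u a)
        ≈⟨ +-cong (*-congʳ (p-rec k)) (*-congˡ (u-rec a)) ⟩
      S (λ i → (x - q ^ i * y) * p i) k * u a + q ^ k * p k * S u a
        ≈⟨ +-cong (S-*ʳ _ (λ _ → u a) k) (S-*ˡ _ (λ _ → q ^ k * p k) a) ⟩
      S (λ i → f₁ i a) k + S (f₂ k) a ∎

    -- A power qᵏ is not constant along the convolution. It is traded for q^(k+a) by means of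
    -- multiples of 1 - qᵏ and qᵏ (1 - qᵃ), each of which lowers an index again.
    step₂ : ∀ k a → f₁ k a + f₂ k a ≈
      (1# + x - y * q ^ (k ℕ.+ a)) * (p k * u a)
        + (- 1# * S (λ i → f₁ i a) k + - y * S (f₂ k) a)
    step₂ k a = begin
      f₁ k a + f₂ k a
        ≈⟨ solve 6 (λ x y s t p u → (x :- s :* y) :* p :* u :+ s :* p :* u
             := (:1 :+ x :- y :* (s :* t)) :* (p :* u)
                :+ (:- :1 :* ((:1 :- s) :* p :* u) :+ :- y :* (s :* p :* ((:1 :- t) :* u))))
             refl x y _ _ _ _ ⟩
      (1# + x - y * (q ^ k * q ^ a)) * (p k * u a)
        + (- 1# * ((1# - q ^ k) * p k * u a) + - y * (q ^ k * p k * ((1# - q ^ a) * u a)))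
        ≈⟨ +-cong (*-congʳ (+-congˡ (-‿cong (*-congˡ (q^-+ k a)))))
                  (+-cong
                    (*-congˡ (trans (sym (S-*ʳ _ (λ _ → u a) k)) (*-congʳ (sym (p-rec k)))))
                    (*-congˡ (trans (sym (S-*ˡ _ (λ _ → q ^ k * p k) a)) (*-congˡ (sym (u-rec a)))))) ⟨
      (1# + x - y * q ^ (k ℕ.+ a)) * (p k * u a)
        + (- 1# * S (λ i → f₁ i a) k + - y * S (f₂ k) a) ∎

    -- The terms with y qᵏ cancel, so the combination left over by `step₂` is a multiple of `α`.
    f₁+yf₂ : ∀ n → convolution f₁ n + y * convolution f₂ n ≈ x * α n
    f₁+yf₂ n = begin
      convolution f₁ n + y * convolution f₂ n
        ≈⟨ +-congˡ (convolution-weight (λ _ → y) f₂ n) ⟨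
      convolution f₁ n + convolution (λ k a → y * f₂ k a) n
        ≈⟨ convolution-+ f₁ _ n ⟨
      convolution (λ k a → f₁ k a + y * f₂ k a) n
        ≈⟨ convolution-cong n (λ k a → solve 5 (λ x y s p u →
             (x :- s :* y) :* p :* u :+ y :* (s :* p :* u) := x :* (p :* u)) refl x y _ _ _) ⟩
      convolution (λ k a → x * (p k * u a)) n
        ≈⟨ convolution-weight (λ _ → x) _ n ⟩
      x * α n ∎

    sum : ∀ n → convolution (λ k a → f₁ k a + f₂ k a) n ≈ A n
    sum n = begin
      convolution (λ k a → f₁ k a + f₂ k a) n
        ≈⟨ convolution-cong n step₂ ⟩
      convolution (λ k a → (1# + x - y * q ^ (k ℕ.+ a)) * (p k * u a)
        + (- 1# * S (λ i → f₁ i a) k + - y * S (f₂ k) a)) n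
        ≈⟨ trans (convolution-+ _ _ n) (+-cong (convolution-weight (λ n → 1# + x - y * q ^ n) _ n)
             (trans (convolution-+ _ _ n)
               (+-cong (trans (convolution-weight (λ _ → - 1#) _ n) (*-congˡ (convolution-Sˡ f₁ n)))
                       (trans (convolution-weight (λ _ → - y) _ n) (*-congˡ (convolution-Sʳ f₂ n)))))) ⟩
      (1# + x - y * q ^ n) * α n + (- 1# * S (convolution f₁) n + - y * S (convolution f₂) n)
        ≈⟨ +-congˡ (solve 3 (λ y a b → :- :1 :* a :+ :- y :* b := :- (a :+ y :* b)) refl _ _ _) ⟩
      (1# + x - y * q ^ n) * α n - (S (convolution f₁) n + y * S (convolution f₂) n)
        ≈⟨ +-congˡ (-‿cong (trans (+-congˡ (S-*ˡ _ (λ _ → y) n)) (trans (S-+ _ _ n)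
             (trans (S-cong n f₁+yf₂) (sym (S-*ˡ _ (λ _ → x) n)))))) ⟩
      A n ∎

  h-α : ∀ n → h n ≈ ⟨ q ⨾ q ⟩ n * α n
  h-α n = begin
    h n
      ≈⟨ h-sum n ⟩
    ∑< (suc n) (λ k → (⟨ q ⨾ q ⟩ n * (u k * u (n ∸ k))) * P k)
      ≈⟨ convolution-∑ (λ k a → (⟨ q ⨾ q ⟩ n * (u k * u a)) * P k) n ⟩
    convolution (λ k a → (⟨ q ⨾ q ⟩ n * (u k * u a)) * P k) n
      ≈⟨ convolution-cong n (λ k a →
           solve 4 (λ f v w r → (f :* (v :* w)) :* r := f :* ((v :* r) :* w)) refl _ _ _ _) ⟩
    convolution (λ k a → ⟨ q ⨾ q ⟩ n * (p k * u a)) n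
      ≈⟨ convolution-weight (λ _ → ⟨ q ⨾ q ⟩ n) _ n ⟩
    ⟨ q ⨾ q ⟩ n * α n ∎

  α-h : ∀ n → α n ≈ h n * u n
  α-h n = begin
    α n                              ≈⟨ *-identityˡ (α n) ⟨
    1# * α n                         ≈⟨ *-congʳ (u-inverse n) ⟨
    (⟨ q ⨾ q ⟩ n * u n) * α n        ≈⟨ solve 3 (λ f v a → (f :* v) :* a := (f :* a) :* v) refl _ _ _ ⟩
    (⟨ q ⨾ q ⟩ n * α n) * u n        ≈⟨ *-congʳ (h-α n) ⟨
    h n * u n                        ∎

  h-rec : ∀ n → h (suc n) ≈ (1# + x - y * q ^ n) * h n - x * ((1# - q ^ n) * S h n)
  h-rec n = begin
    h (suc n)
      ≈⟨ h-α (suc n) ⟩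
    (⟨ q ⨾ q ⟩ n * (1# - q ^ suc n)) * α (suc n)
      ≈⟨ trans (*-assoc _ _ _) (*-congˡ (α-rec (suc n))) ⟩
    ⟨ q ⨾ q ⟩ n * ((1# + x - y * q ^ n) * α n - x * S α n)
      ≈⟨ solve 5 (λ f c a x s → f :* (c :* a :- x :* s) := c :* (f :* a) :- x :* (f :* s))
           refl _ _ _ _ _ ⟩
    (1# + x - y * q ^ n) * (⟨ q ⨾ q ⟩ n * α n) - x * (⟨ q ⨾ q ⟩ n * S α n)
      ≈⟨ +-cong (*-congˡ (sym (h-α n))) (-‿cong (*-congˡ (lower n))) ⟩
    (1# + x - y * q ^ n) * h n - x * ((1# - q ^ n) * S h n) ∎
    where
    lower : ∀ n → ⟨ q ⨾ q ⟩ n * S α n ≈ (1# - q ^ n) * S h n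
    lower zero    = solve 1 (λ a → a :* :0 := (:1 :- :1) :* :0) refl _
    lower (suc n) = begin
      (⟨ q ⨾ q ⟩ n * (1# - q ^ suc n)) * α n
        ≈⟨ solve 3 (λ f d a → (f :* d) :* a := d :* (f :* a)) refl _ _ _ ⟩
      (1# - q ^ suc n) * (⟨ q ⨾ q ⟩ n * α n)
        ≈⟨ *-congˡ (h-α n) ⟨
      (1# - q ^ suc n) * h n ∎

  -- The recurrence (1 - qⁿ⁺¹) F (n+1) m = T F n m determines F from the F 0 m.
  T : (ℕ → ℕ → Carrier) → ℕ → ℕ → Carrier
  T F n m = (1# + x - y * q ^ n) * F n m - x * S₁ F n m
    + (x * y * S₁ (S₂ (λ i j → q ^ i * F i j)) n m - x * S₂ (λ i j → q ^ i * F i j) n m)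

  T-cong : ∀ {F F′} n → (∀ m → F n m ≈ F′ n m) → (∀ m → S₁ F n m ≈ S₁ F′ n m) →
    ∀ m → T F n m ≈ T F′ n m
  T-cong {F} {F′} n eq eq₁ m =
    +-cong (+-cong (*-congˡ (eq m)) (-‿cong (*-congˡ (eq₁ m))))
           (+-cong (*-congˡ (eq₁₂ n m eq₁))
                   (-‿cong (*-congˡ (S-cong m (λ j → *-congˡ (eq j))))))
    where
    eq₁₂ : ∀ n m → (∀ m → S₁ F n m ≈ S₁ F′ n m) →
      S₁ (S₂ (λ i j → q ^ i * F i j)) n m ≈ S₁ (S₂ (λ i j → q ^ i * F′ i j)) n m
    eq₁₂ zero    m eq = refl
    eq₁₂ (suc n) m eq = S-cong m (λ j → *-congˡ (eq j))

  Recurrence : (ℕ → ℕ → Carrier) → Set ℓ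
  Recurrence F = ∀ n m → (1# - q ^ n) * F n m ≈ S₁ (T F) n m

  -- `T F n` reads only the rows n and n - 1 of `F`, so the induction carries both; `cancel` removes
  -- the factor 1 - qⁿ⁺¹.
  unique : ∀ {F F′} → Recurrence F → Recurrence F′ → (∀ m → F 0 m ≈ F′ 0 m) →
    ∀ n m → F n m ≈ F′ n m
  unique {F} {F′} rec rec′ eq₀ n = proj₁ (go n)
    where
    go : ∀ n → (∀ m → F n m ≈ F′ n m) × (∀ m → S₁ F n m ≈ S₁ F′ n m)
    go zero    = eq₀ , λ m → refl
    go (suc n) = let eq , eq₁ = go n in
      (λ m → cancel n (trans (rec (suc n) m)
                        (trans (T-cong n eq eq₁ m) (sym (rec′ (suc n) m))))) , eq

  S₂-scale : ∀ c F n m → S₂ (λ i j → c * F i j) n m ≈ c * S₂ F n m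
  S₂-scale c F n m = sym (S-*ˡ (F n) (λ _ → c) m)

  S₁₂-scale : ∀ c F n m → S₁ (S₂ (λ i j → c * F i j)) n m ≈ c * S₁ (S₂ F) n m
  S₁₂-scale c F n m = trans (S₁-cong n m (S₂-scale c F)) (sym (S-*ˡ (λ i → S₂ F i m) (λ _ → c) n))

  -- Here the factor 1 - qᵏ lowers k. The powers qⁱ and qᵃ merge into q^(i+a), a weight that is
  -- constant along `diagonal`. The cofactor `w` may depend on k, as it does on the left side of the
  -- identity.
  E-shift : ∀ z (g : ℕ → Carrier) k a (w : ℕ → Carrier) → (∀ i → w (suc i) ≈ g i) →
    q ^ a * ((1# - q ^ k) * E z k) * w k ≈ S (λ i → - z * q ^ (i ℕ.+ a) * (E z i * g i)) k
  E-shift z g k a w w≈g = begin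
    q ^ a * ((1# - q ^ k) * E z k) * w k
      ≈⟨ *-congʳ (*-congˡ (E-rec z k)) ⟩
    q ^ a * S (λ i → (- z * q ^ i) * E z i) k * w k
      ≈⟨ solve 3 (λ t s w → t :* s :* w := s :* (t :* w)) refl _ _ _ ⟩
    S (λ i → (- z * q ^ i) * E z i) k * (q ^ a * w k)
      ≈⟨ S-*ʳ _ (λ k → q ^ a * w k) k ⟩
    S (λ i → (- z * q ^ i) * E z i * (q ^ a * w (suc i))) k
      ≈⟨ S-cong k (λ i → trans
           (solve 5 (λ z s e t w → (z :* s) :* e :* (t :* w) := z :* (s :* t) :* (e :* w)) refl _ _ _ _ _)
           (*-cong (*-congˡ (sym (q^-+ i a))) (*-congˡ (w≈g i)))) ⟩
    S (λ i → - z * q ^ (i ℕ.+ a) * (E z i * g i)) k ∎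

  -- The recurrence for the right side.

  g : ℕ → ℕ → ℕ → Carrier
  g k a b = E x k * (α a * α b)

  -- `α-rec` treats the part of 1 - q^(k+a) that lowers a, and `E-shift` the part that lowers k; the
  -- latter is the source of the terms shifted in m.
  D-rec : Recurrence (diagonal g)
  D-rec n m = begin
    (1# - q ^ n) * D n m
      ≈⟨ diagonal-weight (λ n → 1# - q ^ n) g n m ⟨
    diagonal (λ k a b → (1# - q ^ (k ℕ.+ a)) * g k a b) n m
      ≈⟨ diagonal-cong n m step₁ ⟩
    diagonal (λ k a b → S₁ (X k) a b + S (λ i → Y i a b) k) n m
      ≈⟨ diagonal-+ (λ k → S₁ (X k)) (λ k a b → S (λ i → Y i a b) k) n m ⟩
    diagonal (λ k → S₁ (X k)) n m + diagonal (λ k a b → S (λ i → Y i a b) k) n m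
      ≈⟨ +-cong (diagonal-S₁ X n m) (diagonal-S₁₂ Y n m) ⟩
    S₁ (diagonal X) n m + S₁ (S₂ (diagonal Y)) n m
      ≈⟨ S-+ _ _ n ⟩
    S₁ (λ i j → diagonal X i j + S₂ (diagonal Y) i j) n m
      ≈⟨ S₁-cong n m sum ⟩
    S₁ (T D) n m ∎
    where
    D QD : ℕ → ℕ → Carrier
    D = diagonal g
    QD i j = q ^ i * D i j

    X Y : ℕ → ℕ → ℕ → Carrier
    X k a b = E x k * (A a * α b)
    Y k a b = - x * q ^ (k ℕ.+ a) * g k a b

    step₁ : ∀ k a b → (1# - q ^ (k ℕ.+ a)) * g k a b ≈ S₁ (X k) a b + S (λ i → Y i a b) k
    step₁ k a b = begin
      (1# - q ^ (k ℕ.+ a)) * g k a b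
        ≈⟨ *-congʳ (+-congˡ (-‿cong (q^-+ k a))) ⟩
      (1# - q ^ k * q ^ a) * g k a b
        ≈⟨ solve 5 (λ s t e u v → (:1 :- s :* t) :* (e :* (u :* v))
             := (:1 :- t) :* u :* (e :* v) :+ t :* ((:1 :- s) :* e) :* (u :* v)) refl _ _ _ _ _ ⟩
      (1# - q ^ a) * α a * (E x k * α b) + q ^ a * ((1# - q ^ k) * E x k) * (α a * α b)
        ≈⟨ +-cong
             (trans (*-congʳ (α-rec a)) (trans (S-*ʳ A (λ _ → E x k * α b) a)
               (S-cong a (λ i → solve 3 (λ u e v → u :* (e :* v) := e :* (u :* v)) refl _ _ _))))
             (E-shift x (λ _ → α a * α b) k a (λ _ → α a * α b) (λ _ → refl)) ⟩
      S₁ (X k) a b + S (λ i → Y i a b) k ∎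

    -- `A` brings in y qᵃ, whereas only y q^(k+a) is a function of n; their difference contains qᵃ
    -- (1 - qᵏ) and so lowers k once more.
    step₂ : ∀ k a b → X k a b ≈ (1# + x - y * q ^ (k ℕ.+ a)) * g k a b
      + (- y * S (λ i → Y i a b) k + - x * S₁ (g k) a b)
    step₂ k a b = begin
      E x k * (((1# + x - y * q ^ a) * α a - x * S α a) * α b)
        ≈⟨ solve 8 (λ x y s t e u v w →
             e :* (((:1 :+ x :- y :* t) :* u :- x :* w) :* v)
             := (:1 :+ x :- y :* (s :* t)) :* (e :* (u :* v))
                :+ (:- y :* (t :* ((:1 :- s) :* e) :* (u :* v)) :+ :- x :* ((e :* v) :* w)))
             refl x y (q ^ k) (q ^ a) (E x k) (α a) (α b) (S α a) ⟩
      (1# + x - y * (q ^ k * q ^ a)) * g k a b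
        + (- y * (q ^ a * ((1# - q ^ k) * E x k) * (α a * α b)) + - x * ((E x k * α b) * S α a))
        ≈⟨ +-cong (*-congʳ (+-congˡ (-‿cong (*-congˡ (sym (q^-+ k a))))))
             (+-cong (*-congˡ (E-shift x (λ _ → α a * α b) k a (λ _ → α a * α b) (λ _ → refl)))
               (*-congˡ (trans (S-*ˡ α (λ _ → E x k * α b) a)
                 (S-cong a (λ i → solve 3 (λ u e v → (e :* v) :* u := e :* (u :* v)) refl _ _ _))))) ⟩
      (1# + x - y * q ^ (k ℕ.+ a)) * g k a b
        + (- y * S (λ i → Y i a b) k + - x * S₁ (g k) a b) ∎

    Y≈ : ∀ i j → diagonal Y i j ≈ - x * QD i j
    Y≈ i j = trans (diagonal-weight (λ n → - x * q ^ n) g i j) (*-assoc _ _ _)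

    sum : ∀ n m → diagonal X n m + S₂ (diagonal Y) n m ≈ T D n m
    sum n m = begin
      diagonal X n m + S₂ (diagonal Y) n m
        ≈⟨ +-congʳ (trans (diagonal-cong n m step₂) (trans (diagonal-+ _ _ n m)
             (+-cong (diagonal-weight (λ n → 1# + x - y * q ^ n) g n m)
               (trans (diagonal-+ _ _ n m) (+-cong
                 (trans (diagonal-weight (λ _ → - y) _ n m) (*-congˡ (diagonal-S₁₂ Y n m)))
                 (trans (diagonal-weight (λ _ → - x) _ n m) (*-congˡ (diagonal-S₁ g n m)))))))) ⟩
      ((1# + x - y * q ^ n) * D n m + (- y * S₁ (S₂ (diagonal Y)) n m + - x * S₁ D n m))
        + S₂ (diagonal Y) n m
        ≈⟨ +-cong (+-congˡ (+-congʳ (*-congˡ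
             (trans (S₁-cong n m (λ i j → S₂-cong i j Y≈)) (S₁₂-scale (- x) QD n m)))))
             (trans (S₂-cong n m Y≈) (S₂-scale (- x) QD n m)) ⟩
      ((1# + x - y * q ^ n) * D n m + (- y * (- x * S₁ (S₂ QD) n m) + - x * S₁ D n m))
        + - x * S₂ QD n m
        ≈⟨ solve 6 (λ x y c s t v →
             (c :+ (:- y :* (:- x :* s) :+ :- x :* t)) :+ :- x :* v
             := c :- x :* t :+ (x :* y :* s :- x :* v)) refl x y _ _ _ _ ⟩
      T D n m ∎

  -- The recurrence for the left side.

  f : (ℕ → Carrier) → ℕ → ℕ → ℕ → Carrier
  f H k a b = E y k * (u a * u b * H (k ℕ.+ a ℕ.+ b))

  f-shift : ∀ H k a b → (1# - q ^ (k ℕ.+ a)) * f H k a b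
    ≈ S₁ (f (H ∘ suc) k) a b + S (λ i → - y * q ^ (i ℕ.+ a) * f (H ∘ suc) i a b) k
  -- Lowering a or k in the other factors leaves the argument of `H` as it was, one more than the
  -- new k + a + b; hence `H ∘ suc` on the right and the generality in `H`.
  f-shift H k a b = begin
    (1# - q ^ (k ℕ.+ a)) * f H k a b
      ≈⟨ *-congʳ (+-congˡ (-‿cong (q^-+ k a))) ⟩
    (1# - q ^ k * q ^ a) * f H k a b
      ≈⟨ solve 6 (λ s t e u v w → (:1 :- s :* t) :* (e :* (u :* v :* w))
           := (:1 :- t) :* u :* (e :* v :* w) :+ t :* ((:1 :- s) :* e) :* (u :* v :* w))
           refl _ _ _ _ _ _ ⟩
    (1# - q ^ a) * u a * (E y k * u b * H (k ℕ.+ a ℕ.+ b))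
      + q ^ a * ((1# - q ^ k) * E y k) * (u a * u b * H (k ℕ.+ a ℕ.+ b))
      ≈⟨ +-cong
           (trans (*-congʳ (u-rec a)) (trans (S-*ʳ u (λ a → E y k * u b * H (k ℕ.+ a ℕ.+ b)) a)
             (S-cong a (λ i → trans
               (*-congˡ (*-congˡ (reflexive (≡.cong (λ j → H (j ℕ.+ b)) (ℕ.+-suc k i)))))
               (solve 4 (λ u e v w → u :* (e :* v :* w) := e :* (u :* v :* w)) refl _ _ _ _)))))
           (E-shift y (λ k → u a * u b * H (suc (k ℕ.+ a ℕ.+ b))) k a
             (λ k → u a * u b * H (k ℕ.+ a ℕ.+ b)) (λ _ → refl)) ⟩
    S₁ (f (H ∘ suc) k) a b + S (λ i → - y * q ^ (i ℕ.+ a) * f (H ∘ suc) i a b) k ∎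

  f-shift₂ : ∀ H k a b → (1# - q ^ b) * f H k a b ≈ S₂ (f (H ∘ suc) k) a b
  f-shift₂ H k a b = begin
    (1# - q ^ b) * f H k a b
      ≈⟨ solve 5 (λ t e u v w → (:1 :- t) :* (e :* (u :* v :* w))
           := (:1 :- t) :* v :* (e :* u :* w)) refl _ _ _ _ _ ⟩
    (1# - q ^ b) * u b * (E y k * u a * H (k ℕ.+ a ℕ.+ b))
      ≈⟨ trans (*-congʳ (u-rec b)) (S-*ʳ u (λ b → E y k * u a * H (k ℕ.+ a ℕ.+ b)) b) ⟩
    S (λ i → u i * (E y k * u a * H (k ℕ.+ a ℕ.+ suc i))) b
      ≈⟨ S-cong b (λ i → trans
           (*-congˡ (*-congˡ (reflexive (≡.cong H (ℕ.+-suc (k ℕ.+ a) i)))))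
           (solve 4 (λ v e u w → v :* (e :* u :* w) := e :* (u :* v :* w)) refl _ _ _ _)) ⟩
    S₂ (f (H ∘ suc) k) a b ∎

  L : (ℕ → Carrier) → ℕ → ℕ → Carrier
  L H = diagonal (f H)

  QL : (ℕ → Carrier) → ℕ → ℕ → Carrier
  QL H i j = q ^ i * L H i j

  L-shift : ∀ H n m → (1# - q ^ n) * L H n m
    ≈ S₁ (λ i j → L (H ∘ suc) i j - y * S₂ (QL (H ∘ suc)) i j) n m
  L-shift H n m = begin
    (1# - q ^ n) * L H n m
      ≈⟨ diagonal-weight (λ n → 1# - q ^ n) (f H) n m ⟨
    diagonal (λ k a b → (1# - q ^ (k ℕ.+ a)) * f H k a b) n m
      ≈⟨ trans (diagonal-cong n m (f-shift H)) (diagonal-+ _ _ n m) ⟩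
    diagonal (λ k → S₁ (f (H ∘ suc) k)) n m + diagonal (λ k a b → S (λ i → Y i a b) k) n m
      ≈⟨ +-cong (diagonal-S₁ (f (H ∘ suc)) n m) (diagonal-S₁₂ Y n m) ⟩
    S₁ (L (H ∘ suc)) n m + S₁ (S₂ (diagonal Y)) n m
      ≈⟨ S-+ _ _ n ⟩
    S₁ (λ i j → L (H ∘ suc) i j + S₂ (diagonal Y) i j) n m
      ≈⟨ S-cong n (λ i → +-congˡ (trans (S-cong m (Y≈ i))
           (trans (S₂-scale (- y) (QL (H ∘ suc)) i m)
             (solve 2 (λ y s → :- y :* s := :- (y :* s)) refl y _)))) ⟩
    S₁ (λ i j → L (H ∘ suc) i j - y * S₂ (QL (H ∘ suc)) i j) n m ∎
    where
    Y : ℕ → ℕ → ℕ → Carrier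
    Y k a b = - y * q ^ (k ℕ.+ a) * f (H ∘ suc) k a b

    Y≈ : ∀ i j → diagonal Y i j ≈ - y * QL (H ∘ suc) i j
    Y≈ i j = trans (diagonal-weight (λ n → - y * q ^ n) _ i j) (*-assoc _ _ _)

  L-shift₂ : ∀ H n m → diagonal (λ k a b → (1# - q ^ b) * f H k a b) n m ≈ S₂ (L (H ∘ suc)) n m
  L-shift₂ H n m = trans (diagonal-cong n m (f-shift₂ H)) (diagonal-S₂ (f (H ∘ suc)) n m)

  h⁺ : ℕ → Carrier
  h⁺ = h ∘ suc

  -- The three-term recurrence at index k + a + b, sorted by writing q^(k+a+b) as q^(k+a) - q^(k+a)
  -- (1 - qᵇ): every weight then depends on k + a alone, up to a factor 1 - qᵇ that lowers b.
  f-h⁺ : ∀ k a b → f h⁺ k a b ≈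
    ((1# + x - y * q ^ (k ℕ.+ a)) * f h k a b + y * q ^ (k ℕ.+ a) * ((1# - q ^ b) * f h k a b))
    + (- x * ((1# - q ^ (k ℕ.+ a)) * f (S h) k a b)
       + - x * q ^ (k ℕ.+ a) * ((1# - q ^ b) * f (S h) k a b))
  f-h⁺ k a b = trans
    (*-congˡ (*-congˡ (trans (h-rec (k ℕ.+ a ℕ.+ b))
      (+-cong (*-congʳ (+-congˡ (-‿cong (*-congˡ (q^-+ (k ℕ.+ a) b)))))
              (-‿cong (*-congˡ (*-congʳ (+-congˡ (-‿cong (q^-+ (k ℕ.+ a) b))))))))))
    (solve 8 (λ x y s t e u h h′ →
       e :* (u :* ((:1 :+ x :- y :* (s :* t)) :* h :- x :* ((:1 :- s :* t) :* h′)))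
       := ((:1 :+ x :- y :* s) :* (e :* (u :* h)) :+ y :* s :* ((:1 :- t) :* (e :* (u :* h))))
          :+ (:- x :* ((:1 :- s) :* (e :* (u :* h′))) :+ :- x :* s :* ((:1 :- t) :* (e :* (u :* h′)))))
       refl x y (q ^ (k ℕ.+ a)) (q ^ b) (E y k) (u a * u b) _ _)

  L-h⁺ : ∀ n m → L h⁺ n m ≈
    ((1# + x - y * q ^ n) * L h n m + y * q ^ n * S₂ (L h⁺) n m)
    + (- x * ((1# - q ^ n) * L (S h) n m) + - x * q ^ n * S₂ (L h) n m)
  L-h⁺ n m = trans (diagonal-cong n m f-h⁺) (trans (diagonal-+ _ _ n m) (+-cong
    (trans (diagonal-+ _ _ n m) (+-cong
      (diagonal-weight (λ n → 1# + x - y * q ^ n) _ n m)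
      (trans (diagonal-weight (λ n → y * q ^ n) _ n m) (*-congˡ (L-shift₂ h n m)))))
    (trans (diagonal-+ _ _ n m) (+-cong
      (trans (diagonal-weight (λ _ → - x) _ n m)
             (*-congˡ (diagonal-weight (λ n → 1# - q ^ n) _ n m)))
      (trans (diagonal-weight (λ n → - x * q ^ n) _ n m) (*-congˡ (L-shift₂ (S h) n m)))))))

  -- `L-shift` passes from `L h` to `L h⁺` and subtracts y qⁿ times its shift in m; `L-h⁺`
  -- contributes exactly that term, so `h⁺` disappears. The other foreign sequence, `S h`, returns
  -- to `h` by `L-shift`, since `S h ∘ suc` is `h`.
  L-rec : Recurrence (L h)
  L-rec n m = trans (L-shift h n m) (S₁-cong n m step)
    where
    S₁L-S₁₂ : ∀ n m → (1# - q ^ n) * L (S h) n m ≈ S₁ (L h) n m - y * S₁ (S₂ (QL h)) n m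
    S₁L-S₁₂ n m = trans (L-shift (S h) n m) (split n)
      where
      split : ∀ n → S₁ (λ i j → L h i j - y * S₂ (QL h) i j) n m
        ≈ S₁ (L h) n m - y * S₁ (S₂ (QL h)) n m
      split zero    = solve 1 (λ y → :0 := :0 :- y :* :0) refl y
      split (suc n) = refl

    step : ∀ n m → L h⁺ n m - y * S₂ (QL h⁺) n m ≈ T (L h) n m
    step n m = begin
      L h⁺ n m - y * S₂ (QL h⁺) n m
        ≈⟨ +-cong (L-h⁺ n m) (-‿cong (*-congˡ (S₂-scale (q ^ n) (L h⁺) n m))) ⟩
      (((1# + x - y * q ^ n) * L h n m + y * q ^ n * S₂ (L h⁺) n m)
        + (- x * ((1# - q ^ n) * L (S h) n m) + - x * q ^ n * S₂ (L h) n m))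
        - y * (q ^ n * S₂ (L h⁺) n m)
        ≈⟨ +-congʳ (+-congˡ (+-cong (*-congˡ (S₁L-S₁₂ n m))
             (trans (*-assoc _ _ _) (*-congˡ (sym (S₂-scale (q ^ n) (L h) n m)))))) ⟩
      (((1# + x - y * q ^ n) * L h n m + y * q ^ n * S₂ (L h⁺) n m)
        + (- x * (S₁ (L h) n m - y * S₁ (S₂ (QL h)) n m) + - x * S₂ (QL h) n m))
        - y * (q ^ n * S₂ (L h⁺) n m)
        ≈⟨ solve 8 (λ x y s c l₂ l₁ l₁₂ l →
             ((c :+ y :* s :* l₂) :+ (:- x :* (l₁ :- y :* l₁₂) :+ :- x :* l)) :- y :* (s :* l₂)
             := c :- x :* l₁ :+ (x :* y :* l₁₂ :- x :* l)) refl x y (q ^ n) _ _ _ _ _ ⟩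
      T (L h) n m ∎

  linearization : ∀ n m → diagonal (f h) n m ≈ diagonal g n m
  -- For n = 0 only k = 0 occurs, and both sides are h m · u m.
  linearization = unique L-rec D-rec λ m → begin
    E y 0 * (u 0 * u m * h m)       ≈⟨ *-congʳ (E-0 y) ⟩
    1# * (u 0 * u m * h m)          ≈⟨ *-congˡ (trans (*-congʳ (*-congʳ u-0))
                                         (solve 2 (λ v h → (:1 :* v) :* h := :1 :* (h :* v)) refl _ _)) ⟩
    1# * (1# * (h m * u m))         ≈⟨ *-cong (E-0 x) (*-cong α-0 (α-h m)) ⟨
    E x 0 * (α 0 * α m)             ∎
    where
    α-0 : α 0 ≈ 1#
    α-0 = trans (*-cong (trans (trans (*-congˡ P-0) (*-identityʳ (u 0))) u-0) u-0) (*-identityʳ 1#)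

  -- The coefficients of the finite and the infinite product.

  -- coefs N k is the coefficient of zᵏ in (xz;q)_N.
  coefs : ℕ → ℕ → Carrier
  coefs zero    zero    = 1#
  coefs zero    (suc k) = 0#
  coefs (suc N) k       = coefs N k - S (coefs N) k * (x * q ^ N)

  -- By the q-binomial theorem `coefs N k` is [N choose k] (-x)ᵏ q^(k choose 2). The recurrence in k
  -- replaces this formula and also covers k > N, because qⁱ - q^N vanishes at i = N. The induction
  -- on `N` uses the claim for both k + 1 and k.
  coefs-rec : ∀ N k → (1# - q ^ k) * coefs N k ≈ S (λ i → - x * (q ^ i - q ^ N) * coefs N i) k
  coefs-rec N       zero          = 1-1* _
  coefs-rec zero    (suc zero)    =
    solve 2 (λ s x → (:1 :- s) :* :0 := :- x :* (:1 :- :1) :* :1) refl (q ^ 1) x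
  coefs-rec zero    (suc (suc k)) =
    solve 3 (λ s t x → (:1 :- s) :* :0 := :- x :* (t :- :1) :* :0) refl
      (q ^ suc (suc k)) (q ^ suc k) x
  coefs-rec (suc N) (suc k)       = begin
    (1# - q ^ suc k) * (e₁ - e₀ * (x * q ^ N))
      ≈⟨ solve 3 (λ d a b → d :* (a :- b) := d :* a :- d :* b) refl _ _ _ ⟩
    (1# - q ^ suc k) * e₁ - (1# - q ^ suc k) * (e₀ * (x * q ^ N))
      ≈⟨ +-congʳ (coefs-rec N (suc k)) ⟩
    - x * (q ^ k - q ^ N) * e₀ - (1# - q ^ suc k) * (e₀ * (x * q ^ N))
      ≈⟨ solve 5 (λ q s t x e → :- x :* (s :- t) :* e :- (:1 :- q :* s) :* (e :* (x :* t))
           := :- x :* (s :- q :* t) :* e :- q :* ((:1 :- s) :* e) :* (x :* t)) refl q (q ^ k) (q ^ N) x e₀ ⟩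
    - x * (q ^ k - q ^ suc N) * e₀ - q * ((1# - q ^ k) * e₀) * (x * q ^ N)
      ≈⟨ +-congˡ (-‿cong (*-congʳ (trans (*-congˡ (coefs-rec N k)) (lower k)))) ⟩
    - x * (q ^ k - q ^ suc N) * e₀ - - x * (q ^ k - q ^ suc N) * S (coefs N) k * (x * q ^ N)
      ≈⟨ solve 4 (λ w e s t → w :* e :- w :* s :* t := w :* (e :- s :* t)) refl _ _ _ _ ⟩
    - x * (q ^ k - q ^ suc N) * (e₀ - S (coefs N) k * (x * q ^ N)) ∎
    where
    e₀ = coefs N k
    e₁ = coefs N (suc k)
    lower : ∀ k → q * S (λ i → - x * (q ^ i - q ^ N) * coefs N i) k
      ≈ - x * (q ^ k - q ^ suc N) * S (coefs N) k
    lower zero    = solve 3 (λ q x t → q :* :0 := :- x :* (:1 :- t) :* :0) refl q x (q ^ suc N)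
    lower (suc i) = solve 5 (λ q x s t e → q :* (:- x :* (s :- t) :* e)
      := :- x :* (q :* s :- q :* t) :* e) refl q x _ _ _

  -- Found by subtracting `E-rec` from `coefs-rec` and taking out q^N; the division by 1 - qᵏ⁺¹ is
  -- multiplication by (q;q)ₖ u (k+1). `N` enters only through q^N, which permits bounds uniform in
  -- `N`.
  remainder : ℕ → ℕ → Carrier
  remainder N zero    = 0#
  remainder N (suc k) = (⟨ q ⨾ q ⟩ k * u (suc k)) *
    (x * (E x k + (q ^ N * remainder N k - q ^ k * remainder N k)))

  coefs-remainder : ∀ N k → coefs N k ≈ E x k + q ^ N * remainder N k
  coefs-remainder N zero    = begin
    coefs N 0             ≈⟨ coefs-0 N ⟩
    1#                    ≈⟨ E-0 x ⟨
    E x 0                 ≈⟨ solve 2 (λ e t → e := e :+ t :* :0) refl _ _ ⟩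
    E x 0 + q ^ N * 0#    ∎
    where
    coefs-0 : ∀ N → coefs N 0 ≈ 1#
    coefs-0 zero    = refl
    coefs-0 (suc N) = trans (solve 2 (λ e t → e :- :0 :* t := e) refl _ _) (coefs-0 N)
  coefs-remainder N (suc k) = cancel k (begin
    (1# - q ^ suc k) * coefs N (suc k)
      ≈⟨ coefs-rec N (suc k) ⟩
    - x * (q ^ k - q ^ N) * coefs N k
      ≈⟨ *-congˡ (coefs-remainder N k) ⟩
    - x * (q ^ k - q ^ N) * (E x k + q ^ N * r)
      ≈⟨ solve 5 (λ x s t e r → :- x :* (s :- t) :* (e :+ t :* r)
           := (:- x :* s) :* e :+ t :* (:1 :* (x :* (e :+ (t :* r :- s :* r))))) refl
           x (q ^ k) (q ^ N) (E x k) r ⟩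
    (- x * q ^ k) * E x k + q ^ N * (1# * (x * (E x k + (q ^ N * r - q ^ k * r))))
      ≈⟨ +-cong (E-rec x (suc k)) (*-congˡ (*-congʳ (u-inverse (suc k)))) ⟨
    (1# - q ^ suc k) * E x (suc k)
      + q ^ N * ((⟨ q ⨾ q ⟩ suc k * u (suc k)) * (x * (E x k + (q ^ N * r - q ^ k * r))))
      ≈⟨ solve 6 (λ d e t f v w → d :* e :+ t :* ((f :* d :* v) :* w)
           := d :* (e :+ t :* ((f :* v) :* w))) refl _ _ _ _ _ _ ⟩
    (1# - q ^ suc k) * (E x (suc k) + q ^ N * remainder N (suc k)) ∎)
    where r = remainder N k

  G-closed : ∀ z k → (- 1#) ^ k * z ^ k * q ^ (k C 2) ≈ G z k
  G-closed z zero    = trans (*-identityʳ _) (*-identityʳ 1#)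
  G-closed z (suc k) = begin
    (- 1# * (- 1#) ^ k) * (z * z ^ k) * q ^ (suc k C 2)
      ≈⟨ *-congˡ (trans (reflexive (≡.cong (q ^_) exponent)) (q^-+ k (k C 2))) ⟩
    (- 1# * (- 1#) ^ k) * (z * z ^ k) * (q ^ k * q ^ (k C 2))
      ≈⟨ solve 5 (λ s z w t r → (:- :1 :* s) :* (z :* w) :* (t :* r)
           := s :* w :* r :* (:- z :* t)) refl _ _ _ _ _ ⟩
    (- 1#) ^ k * z ^ k * q ^ (k C 2) * (- z * q ^ k)
      ≈⟨ *-congʳ (G-closed z k) ⟩
    G z k * (- z * q ^ k) ∎
    where
    exponent : suc k C 2 ≡ k ℕ.+ k C 2
    exponent = ≡.trans (≡.sym (nCk+nC[k+1]≡[n+1]C[k+1] k 1)) (≡.cong (ℕ._+ k C 2) (nC1≡n k))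

  coefs-zero : ∀ {𝟙} → Monomial 0 0 1# 𝟙 → ∀ n m → 𝟙 n m ≈ Δ (coefs 0) n m
  coefs-zero M zero    zero    = coefficient M
  coefs-zero M zero    (suc m) = off₂ M 0 (suc m) λ ()
  coefs-zero M (suc n) m       = trans (off₁ M (suc n) m λ ()) (sym (vanish m))
    where
    vanish : ∀ m → Δ (coefs 0) (suc n) m ≈ 0#
    vanish zero    = refl
    vanish (suc m) with Δ-entry n m
    ... | inj₁ (k , eq) = reflexive (eq (coefs 0 ∘ suc))
    ... | inj₂ eq       = reflexive (eq (coefs 0 ∘ suc))

  -- The factor 1 - x q^N ts acts on the coefficients of powers of ts by the recursion that defines
  -- `coefs`.
  coefs-suc : ∀ {F 𝟙 G H} N → (∀ n m → F n m ≈ Δ (coefs N) n m) →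
    Monomial 0 0 1# 𝟙 → Monomial 1 1 (x * q ^ N) G → (∀ n m → H n m ≈ 𝟙 n m - G n m) →
    ∀ n m → (F ⊛ H) n m ≈ Δ (coefs (suc N)) n m
  coefs-suc {F} {𝟙} {G} {H} N F≈ M M′ H≈ n m = begin
    (F ⊛ H) n m
      ≈⟨ ∑-cong (suc n) (λ i → ∑-cong (suc m) λ j → *-congˡ (H≈ (n ∸ i) (m ∸ j))) ⟩
    (F ⊛ (λ i j → 𝟙 i j - G i j)) n m
      ≈⟨ ⊛-1-ts F M M′ n m ⟩
    F n m - S₁ (S₂ F) n m * (x * q ^ N)
      ≈⟨ +-cong (F≈ n m) (-‿cong (*-congʳ (S₁-cong n m λ i j → S₂-cong i j F≈))) ⟩
    Δ (coefs N) n m - S₁ (S₂ (Δ (coefs N))) n m * (x * q ^ N)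
      ≈⟨ Δ-1-ts (coefs N) (x * q ^ N) n m ⟨
    Δ (coefs (suc N)) n m ∎

  Δ-remainder : ∀ N n m → Δ (coefs N) n m ≈ Δ (E x) n m + q ^ N * Δ (remainder N) n m
  Δ-remainder N n m with Δ-entry n m
  ... | inj₁ (k , eq) = begin
    Δ (coefs N) n m                             ≡⟨ eq (coefs N) ⟩
    coefs N k                                   ≈⟨ coefs-remainder N k ⟩
    E x k + q ^ N * remainder N k               ≡⟨ ≡.cong₂ (λ a b → a + q ^ N * b) (eq (E x)) (eq (remainder N)) ⟨
    Δ (E x) n m + q ^ N * Δ (remainder N) n m   ∎
  ... | inj₂ eq = begin
    Δ (coefs N) n m                             ≡⟨ eq (coefs N) ⟩
    0#                                          ≈⟨ solve 1 (λ t → :0 := :0 :+ t :* :0) refl (q ^ N) ⟩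
    0# + q ^ N * 0#                             ≡⟨ ≡.cong₂ (λ a b → a + q ^ N * b) (eq (E x)) (eq (remainder N)) ⟨
    Δ (E x) n m + q ^ N * Δ (remainder N) n m   ∎

  -- The factors 1# come from tⁿ and sᵐ.
  lhs-term : ℕ → ℕ → ℕ → Carrier
  lhs-term k n m = h (n ℕ.+ m ∸ k) * (1# * u (n ∸ k)) * (1# * u (m ∸ k))

  rhs-term : ℕ → ℕ → Carrier
  rhs-term n m = h n * h m * (1# * u n) * (1# * u m)

  coefficient-identity : ∀ n m →
    diagonal (λ k a b → E y k * lhs-term k (k ℕ.+ a) (k ℕ.+ b)) n m
      ≈ diagonal (λ k a b → E x k * rhs-term a b) n m
  coefficient-identity n m = begin
    diagonal (λ k a b → E y k * lhs-term k (k ℕ.+ a) (k ℕ.+ b)) n m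
      ≈⟨ diagonal-cong n m (λ k a b → *-congˡ (trans
           (*-cong (*-cong (reflexive (≡.cong h (index k a b))) (*-congˡ (reflexive (≡.cong u (ℕ.m+n∸m≡n k a)))))
                   (*-congˡ (reflexive (≡.cong u (ℕ.m+n∸m≡n k b)))))
           (solve 3 (λ h v w → h :* (:1 :* v) :* (:1 :* w) := v :* w :* h) refl _ _ _))) ⟩
    diagonal (f h) n m
      ≈⟨ linearization n m ⟩
    diagonal g n m
      ≈⟨ diagonal-cong n m (λ k a b → *-congˡ (trans (*-cong (α-h a) (α-h b))
           (solve 4 (λ h v h′ w → h :* v :* (h′ :* w) := h :* h′ :* (:1 :* v) :* (:1 :* w)) refl _ _ _ _))) ⟩
    diagonal (λ k a b → E x k * rhs-term a b) n m ∎
    where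
    index : ∀ k a b → k ℕ.+ a ℕ.+ (k ℕ.+ b) ∸ k ≡ k ℕ.+ a ℕ.+ b
    index k a b = ≡.trans (≡.cong (_∸ k) (ℕ.+-assoc k a (k ℕ.+ b)))
      (≡.trans (ℕ.m+n∸m≡n k (a ℕ.+ (k ℕ.+ b)))
      (≡.trans (≡.sym (ℕ.+-assoc a k b)) (≡.cong (ℕ._+ b) (ℕ.+-comm a k))))

-- Inequalities between rationals.

module Rational where
  open +-*-Solver

  *-pos : ∀ {p q} → 0ℚ ℚ.< p → 0ℚ ℚ.< q → 0ℚ ℚ.< p ℚ.* q
  *-pos {p} {q} 0<p 0<q = ℚ.positive⁻¹ (p ℚ.* q)
    {{ℚ.pos*pos⇒pos p {{ℚ.positive 0<p}} q {{ℚ.positive 0<q}}}}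

  *-monoˡ-≤ : ∀ {p q} r → 0ℚ ℚ.≤ r → p ℚ.≤ q → r ℚ.* p ℚ.≤ r ℚ.* q
  *-monoˡ-≤ r 0≤r = ℚ.*-monoˡ-≤-nonNeg r {{ℚ.nonNegative 0≤r}}

  *-mono-≤ : ∀ {p q r s} → 0ℚ ℚ.≤ q → 0ℚ ℚ.≤ r → p ℚ.≤ q → r ℚ.≤ s → p ℚ.* r ℚ.≤ q ℚ.* s
  *-mono-≤ {q = q} {r} 0≤q 0≤r p≤q r≤s = ℚ.≤-trans
    (ℚ.*-monoʳ-≤-nonNeg r {{ℚ.nonNegative 0≤r}} p≤q) (*-monoˡ-≤ q 0≤q r≤s)

  *-nonNeg : ∀ {p q} → 0ℚ ℚ.≤ p → 0ℚ ℚ.≤ q → 0ℚ ℚ.≤ p ℚ.* q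
  *-nonNeg {p} {q} 0≤p 0≤q = ≡.subst (ℚ._≤ p ℚ.* q) (ℚ.*-zeroʳ p) (*-monoˡ-≤ p 0≤p 0≤q)

  sq-nonNeg : ∀ p → 0ℚ ℚ.≤ p ℚ.* p
  sq-nonNeg p with ℚ.≤-total 0ℚ p
  ... | inj₁ 0≤p = *-nonNeg 0≤p 0≤p
  ... | inj₂ p≤0 = ≡.subst (ℚ._≤ p ℚ.* p) (ℚ.*-zeroʳ p)
    (ℚ.*-monoˡ-≤-nonPos p {{ℚ.nonPositive p≤0}} p≤0)

  half-pos : ∀ {p} → 0ℚ ℚ.< p → 0ℚ ℚ.< ½ ℚ.* p
  half-pos = *-pos (ℚ.positive⁻¹ ½)

  half+half : ∀ p → ½ ℚ.* p ℚ.+ ½ ℚ.* p ≡ p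
  half+half = solve 1 (λ p → con ½ :* p :+ con ½ :* p := p) ≡.refl

  p≤p+q : ∀ p {q} → 0ℚ ℚ.≤ q → p ℚ.≤ p ℚ.+ q
  p≤p+q p {q} 0≤q = ≡.subst (ℚ._≤ p ℚ.+ q) (ℚ.+-identityʳ p) (ℚ.+-monoʳ-≤ p 0≤q)

  p≤∣p∣ : ∀ p → p ℚ.≤ ℚ.∣ p ∣
  p≤∣p∣ p with ℚ.≤-total 0ℚ p
  ... | inj₁ 0≤p = ℚ.≤-reflexive (≡.sym (ℚ.0≤p⇒∣p∣≡p 0≤p))
  ... | inj₂ p≤0 = ℚ.≤-trans p≤0 (ℚ.0≤∣p∣ p)

  ∣∣-+-< : ∀ {p q r ε} → p ℚ.+ q ≡ r →
    ℚ.∣ p ∣ ℚ.< ½ ℚ.* ε → ℚ.∣ q ∣ ℚ.< ½ ℚ.* ε → ℚ.∣ r ∣ ℚ.< ε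
  ∣∣-+-< {p} {q} {ε = ε} ≡.refl p< q< = ≡.subst (ℚ.∣ p ℚ.+ q ∣ ℚ.<_) (half+half ε)
    (ℚ.≤-<-trans (ℚ.∣p+q∣≤∣p∣+∣q∣ p q) (ℚ.+-mono-< p< q<))

  ℕ→ℚ : ℕ → ℚ
  ℕ→ℚ k = ℚ.fromℤ (+ k)

  ℕ→ℚ-suc : ∀ k → ℕ→ℚ (suc k) ≡ 1ℚ ℚ.+ ℕ→ℚ k
  ℕ→ℚ-suc k = ℚ.toℚᵘ-injective (ℚᵘ.≃-trans
    (ℚᵘ.*≡* (≡.cong (λ i → (+ 1 ℤ.+ i) ℤ.* + 1) (≡.sym (ℤ.*-identityʳ (+ k)))))
    (ℚᵘ.≃-sym (ℚ.toℚᵘ-homo-+ 1ℚ (ℕ→ℚ k))))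

  ℕ→ℚ-mono : ∀ {k l} → k ℕ.≤ l → ℕ→ℚ k ℚ.≤ ℕ→ℚ l
  ℕ→ℚ-mono k≤l = ℚ.*≤* (ℤ.*-monoʳ-≤-nonNeg (+ 1) (ℤ.+≤+ k≤l))

  -- For p = (1 + a) / (1 + d) the denominator serves as `k`, as (1 + d) p = 1 + a ≥ 1.
  archimedean : ∀ p → 0ℚ ℚ.< p → ∃[ k ] 1ℚ ℚ.≤ ℕ→ℚ k ℚ.* p
  archimedean (mkℚ (+ zero) d _) (ℚ.*<* 0<0) = contradiction 0<0 (ℤ.<-irrefl ≡.refl)
  archimedean p@(mkℚ +[1+ a ] d _) _ = suc d , ℚ.toℚᵘ-cancel-≤ (ℚᵘ.≤-trans
    (ℚᵘ.*≤* (ℤ.+≤+ bound)) (ℚᵘ.≤-reflexive (ℚᵘ.≃-sym (ℚ.toℚᵘ-homo-* (ℕ→ℚ (suc d)) p))))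
    where
    open ℕ.≤-Reasoning
    bound : 1 ℕ.* (1 ℕ.* suc d) ℕ.≤ (suc d ℕ.* suc a) ℕ.* 1
    bound = begin
      1 ℕ.* (1 ℕ.* suc d)     ≡⟨ ≡.trans (ℕ.*-identityˡ _) (ℕ.*-identityˡ (suc d)) ⟩
      suc d                   ≤⟨ ℕ.m≤m*n (suc d) (suc a) ⟩
      suc d ℕ.* suc a         ≡⟨ ℕ.*-identityʳ _ ⟨
      (suc d ℕ.* suc a) ℕ.* 1 ∎

-- The field operations of `ℂ` up to `≈ᶜ`.

module Complex where
  open Rational
  open +-*-Solver

  eventually-≡⇒≈ᴿ : ∀ {x y} N → (∀ n → N ℕ.≤ n → seq x n ≡ seq y n) → x ≈ᴿ y
  eventually-≡⇒≈ᴿ {x} {y} N eq ε 0<ε = N , λ n N≤n → ≡.subst (ℚ._< ε)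
    (≡.cong ℚ.∣_∣ (≡.trans (≡.sym (ℚ.+-inverseʳ (seq y n)))
                           (≡.cong (ℚ._- seq y n) (≡.sym (eq n N≤n)))))
    0<ε

  ≡⇒≈ᴿ : ∀ x y → (∀ n → seq x n ≡ seq y n) → x ≈ᴿ y
  ≡⇒≈ᴿ x y eq = eventually-≡⇒≈ᴿ {x} {y} 0 (λ n _ → eq n)

  ≈ᴿ-sym : ∀ {x y} → x ≈ᴿ y → y ≈ᴿ x
  ≈ᴿ-sym {x} {y} x≈y ε 0<ε = let N , close = x≈y ε 0<ε in N , λ n N≤n →
    ≡.subst (ℚ._< ε)
      (≡.trans (≡.sym (ℚ.∣-p∣≡∣p∣ (seq x n ℚ.- seq y n)))
               (≡.cong ℚ.∣_∣ (solve 2 (λ a b → :- (a :- b) := b :- a) ≡.refl (seq x n) (seq y n))))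
      (close n N≤n)

  combine : ∀ (x y x′ y′ v w : ℕ → ℚ) →
    (∀ n → (x n ℚ.- y n) ℚ.+ (x′ n ℚ.- y′ n) ≡ v n ℚ.- w n) → ∀ ε →
    ∃[ N ] (∀ n → N ℕ.≤ n → ℚ.∣ x n ℚ.- y n ∣ ℚ.< ½ ℚ.* ε) →
    ∃[ N ] (∀ n → N ℕ.≤ n → ℚ.∣ x′ n ℚ.- y′ n ∣ ℚ.< ½ ℚ.* ε) →
    ∃[ N ] (∀ n → N ℕ.≤ n → ℚ.∣ v n ℚ.- w n ∣ ℚ.< ε)
  combine x y x′ y′ v w eq ε (N , close) (M , close′) = N ℕ.⊔ M , λ n ≤n →
    ∣∣-+-< (eq n) (close n (ℕ.m⊔n≤o⇒m≤o N M ≤n)) (close′ n (ℕ.m⊔n≤o⇒n≤o N M ≤n))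

  ≈ᴿ-trans : ∀ {x y z} → x ≈ᴿ y → y ≈ᴿ z → x ≈ᴿ z
  ≈ᴿ-trans {x} {y} {z} x≈y y≈z ε 0<ε = combine (seq x) (seq y) (seq y) (seq z) (seq x) (seq z)
    (λ n → solve 3 (λ a b c → (a :- b) :+ (b :- c) := a :- c) ≡.refl (seq x n) (seq y n) (seq z n))
    ε (x≈y _ (half-pos 0<ε)) (y≈z _ (half-pos 0<ε))

  +ᴿ-cong : ∀ {x x′ y y′} → x ≈ᴿ x′ → y ≈ᴿ y′ → x +ᴿ y ≈ᴿ x′ +ᴿ y′
  +ᴿ-cong {x} {x′} {y} {y′} x≈x′ y≈y′ ε 0<ε = combine
    (seq x) (seq x′) (seq y) (seq y′) (seq (x +ᴿ y)) (seq (x′ +ᴿ y′))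
    (λ n → solve 4 (λ a b c d → (a :- b) :+ (c :- d) := (a :+ c) :- (b :+ d)) ≡.refl
      (seq x n) (seq x′ n) (seq y n) (seq y′ n))
    ε (x≈x′ _ (half-pos 0<ε)) (y≈y′ _ (half-pos 0<ε))

  -ᴿ-cong : ∀ {x x′} → x ≈ᴿ x′ → -ᴿ x ≈ᴿ -ᴿ x′
  -ᴿ-cong {x} {x′} x≈x′ ε 0<ε = let N , close = x≈x′ ε 0<ε in N , λ n N≤n →
    ≡.subst (ℚ._< ε)
      (≡.trans (≡.sym (ℚ.∣-p∣≡∣p∣ (seq x n ℚ.- seq x′ n)))
               (≡.cong ℚ.∣_∣ (solve 2 (λ a b → :- (a :- b) := :- a :- :- b) ≡.refl (seq x n) (seq x′ n))))
      (close n N≤n)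

  *ᴿ-cong : ∀ {x x′ y y′} → x ≈ᴿ x′ → y ≈ᴿ y′ → x *ᴿ y ≈ᴿ x′ *ᴿ y′
  *ᴿ-cong {x} {x′} {y} {y′} x≈x′ y≈y′ ε 0<ε =
    let A , M₁ , 0<A , x≤A  = cauchy-bounded (seq x) (cauchy x)
        B , M₂ , 0<B , y′≤B = cauchy-bounded (seq y′) (cauchy y′)
        δ , 0<δ , eq        = split-ε A B ε 0<A 0<B 0<ε
        N₁ , close          = x≈x′ δ 0<δ
        N₂ , close′         = y≈y′ δ 0<δ
    in (M₁ ℕ.⊔ M₂) ℕ.⊔ (N₁ ℕ.⊔ N₂) , λ n ≤n →
      let M≤n = ℕ.m⊔n≤o⇒m≤o (M₁ ℕ.⊔ M₂) (N₁ ℕ.⊔ N₂) ≤n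
          N≤n = ℕ.m⊔n≤o⇒n≤o (M₁ ℕ.⊔ M₂) (N₁ ℕ.⊔ N₂) ≤n
      in ≡.subst (ℚ.∣ seq x n ℚ.* seq y n ℚ.- seq x′ n ℚ.* seq y′ n ∣ ℚ.<_) eq
           (product-close A B δ (seq x n) (seq y n) (seq x′ n) (seq y′ n) 0<A 0<B
             (x≤A n (ℕ.m⊔n≤o⇒m≤o M₁ M₂ M≤n)) (y′≤B n (ℕ.m⊔n≤o⇒n≤o M₁ M₂ M≤n))
             (close n (ℕ.m⊔n≤o⇒m≤o N₁ N₂ N≤n)) (close′ n (ℕ.m⊔n≤o⇒n≤o N₁ N₂ N≤n)))

  -- Half of the gap pays for the distance between `x` and `y`; the other half is the new gap.
  <ᴿ-respˡ-≈ᴿ : ∀ {x y z} → x ≈ᴿ y → y <ᴿ z → x <ᴿ z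
  <ᴿ-respˡ-≈ᴿ {x} {y} {z} x≈y (ε , N , 0<ε , y+ε≤z) =
    let M , close = x≈y (½ ℚ.* ε) (half-pos 0<ε)
    in ½ ℚ.* ε , N ℕ.⊔ M , half-pos 0<ε , λ n ≤n → begin
      seq x n ℚ.+ ½ ℚ.* ε
        ≡⟨ solve 3 (λ a b e → a :+ e := b :+ ((a :- b) :+ e)) ≡.refl (seq x n) (seq y n) (½ ℚ.* ε) ⟩
      seq y n ℚ.+ ((seq x n ℚ.- seq y n) ℚ.+ ½ ℚ.* ε)
        ≤⟨ ℚ.+-monoʳ-≤ (seq y n) (ℚ.+-monoˡ-≤ (½ ℚ.* ε)
             (ℚ.≤-trans (p≤∣p∣ (seq x n ℚ.- seq y n)) (ℚ.<⇒≤ (close n (ℕ.m⊔n≤o⇒n≤o N M ≤n))))) ⟩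
      seq y n ℚ.+ (½ ℚ.* ε ℚ.+ ½ ℚ.* ε)
        ≡⟨ ≡.cong (seq y n ℚ.+_) (half+half ε) ⟩
      seq y n ℚ.+ ε
        ≤⟨ y+ε≤z n (ℕ.m⊔n≤o⇒m≤o N M ≤n) ⟩
      seq z n ∎
    where open ℚ.≤-Reasoning

  private module C = RawRing ℂ-rawRing

  ≡⇒≈ᶜ : ∀ z w → (∀ n → seq (re z) n ≡ seq (re w) n) → (∀ n → seq (im z) n ≡ seq (im w) n) → z ≈ᶜ w
  ≡⇒≈ᶜ z w eq eq′ = ≡⇒≈ᴿ (re z) (re w) eq , ≡⇒≈ᴿ (im z) (im w) eq′

  *ᶜ-cong : ∀ {z z′ w w′} → z ≈ᶜ z′ → w ≈ᶜ w′ → z C.* w ≈ᶜ z′ C.* w′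
  *ᶜ-cong {a +i b} {a′ +i b′} {c +i d} {c′ +i d′} (a≈ , b≈) (c≈ , d≈) =
    +ᴿ-cong {a *ᴿ c} {a′ *ᴿ c′} { -ᴿ (b *ᴿ d)} { -ᴿ (b′ *ᴿ d′)}
      (*ᴿ-cong {a} {a′} {c} {c′} a≈ c≈)
      (-ᴿ-cong {b *ᴿ d} {b′ *ᴿ d′} (*ᴿ-cong {b} {b′} {d} {d′} b≈ d≈)) ,
    +ᴿ-cong {a *ᴿ d} {a′ *ᴿ d′} {b *ᴿ c} {b′ *ᴿ c′}
      (*ᴿ-cong {a} {a′} {d} {d′} a≈ d≈) (*ᴿ-cong {b} {b′} {c} {c′} b≈ c≈)

  ℂ-isCommutativeRing : IsCommutativeRing _≈ᶜ_ C._+_ C._*_ C.-_ C.0# C.1#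
  ℂ-isCommutativeRing = record
      { isRing = record
        { +-isAbelianGroup = record
          { isGroup = record
            { isMonoid = record
              { isSemigroup = record
                { isMagma = record
                  { isEquivalence = record
                    { refl  = λ {z} → ≡⇒≈ᶜ z z (λ _ → ≡.refl) (λ _ → ≡.refl)
                    ; sym   = λ {z} {w} (e , e′) →
                        ≈ᴿ-sym {re z} {re w} e , ≈ᴿ-sym {im z} {im w} e′
                    ; trans = λ {z} {w} {v} (e₁ , e₁′) (e₂ , e₂′) →
                        ≈ᴿ-trans {re z} {re w} {re v} e₁ e₂ , ≈ᴿ-trans {im z} {im w} {im v} e₁′ e₂′
                    }
                  ; ∙-cong = λ {z} {z′} {w} {w′} (e₁ , e₁′) (e₂ , e₂′) →
                      +ᴿ-cong {re z} {re z′} {re w} {re w′} e₁ e₂ ,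
                      +ᴿ-cong {im z} {im z′} {im w} {im w′} e₁′ e₂′
                  }
                ; assoc = λ z w v → ≡⇒≈ᶜ ((z C.+ w) C.+ v) (z C.+ (w C.+ v))
                    (λ n → ℚ.+-assoc (seq (re z) n) (seq (re w) n) (seq (re v) n))
                    (λ n → ℚ.+-assoc (seq (im z) n) (seq (im w) n) (seq (im v) n))
                }
              ; identity =
                  (λ z → ≡⇒≈ᶜ (C.0# C.+ z) z
                      (λ n → ℚ.+-identityˡ (seq (re z) n)) (λ n → ℚ.+-identityˡ (seq (im z) n))) ,
                  (λ z → ≡⇒≈ᶜ (z C.+ C.0#) z
                      (λ n → ℚ.+-identityʳ (seq (re z) n)) (λ n → ℚ.+-identityʳ (seq (im z) n)))
              }
            ; inverse =
                (λ z → ≡⇒≈ᶜ (C.- z C.+ z) C.0#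
                    (λ n → ℚ.+-inverseˡ (seq (re z) n)) (λ n → ℚ.+-inverseˡ (seq (im z) n))) ,
                (λ z → ≡⇒≈ᶜ (z C.+ C.- z) C.0#
                    (λ n → ℚ.+-inverseʳ (seq (re z) n)) (λ n → ℚ.+-inverseʳ (seq (im z) n)))
            ; ⁻¹-cong = λ {z} {w} (e , e′) → -ᴿ-cong {re z} {re w} e , -ᴿ-cong {im z} {im w} e′
            }
          ; comm = λ z w → ≡⇒≈ᶜ (z C.+ w) (w C.+ z) 
              (λ n → ℚ.+-comm (seq (re z) n) (seq (re w) n))
              (λ n → ℚ.+-comm (seq (im z) n) (seq (im w) n))
          }
        ; *-cong = λ {z} {z′} {w} {w′} → *ᶜ-cong {z} {z′} {w} {w′}
        ; *-assoc = λ z w v → ≡⇒≈ᶜ ((z C.* w) C.* v) (z C.* (w C.* v))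
            (λ n → solve 6 (λ a b c d e f →
              (a :* c :+ :- (b :* d)) :* e :+ :- ((a :* d :+ b :* c) :* f)
              := a :* (c :* e :+ :- (d :* f)) :+ :- (b :* (c :* f :+ d :* e))) ≡.refl
              (seq (re z) n) (seq (im z) n) (seq (re w) n) (seq (im w) n) (seq (re v) n) (seq (im v) n))
            (λ n → solve 6 (λ a b c d e f →
              (a :* c :+ :- (b :* d)) :* f :+ (a :* d :+ b :* c) :* e
              := a :* (c :* f :+ d :* e) :+ b :* (c :* e :+ :- (d :* f))) ≡.refl
              (seq (re z) n) (seq (im z) n) (seq (re w) n) (seq (im w) n) (seq (re v) n) (seq (im v) n))
        ; *-identity =
            (λ z → ≡⇒≈ᶜ (C.1# C.* z) z
              (λ n → solve 2 (λ a b → con 1ℚ :* a :+ :- (con 0ℚ :* b) := a) ≡.refl (seq (re z) n) (seq (im z) n))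
              (λ n → solve 2 (λ a b → con 1ℚ :* b :+ con 0ℚ :* a := b) ≡.refl (seq (re z) n) (seq (im z) n))) ,
            (λ z → ≡⇒≈ᶜ (z C.* C.1#) z
              (λ n → solve 2 (λ a b → a :* con 1ℚ :+ :- (b :* con 0ℚ) := a) ≡.refl (seq (re z) n) (seq (im z) n))
              (λ n → solve 2 (λ a b → a :* con 0ℚ :+ b :* con 1ℚ := b) ≡.refl (seq (re z) n) (seq (im z) n)))
        ; distrib =
            (λ z w v → ≡⇒≈ᶜ (z C.* (w C.+ v)) (z C.* w C.+ z C.* v)
              (λ n → solve 6 (λ a b c d e f →
                a :* (c :+ e) :+ :- (b :* (d :+ f))
                := (a :* c :+ :- (b :* d)) :+ (a :* e :+ :- (b :* f))) ≡.refl
                (seq (re z) n) (seq (im z) n) (seq (re w) n) (seq (im w) n) (seq (re v) n) (seq (im v) n))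
              (λ n → solve 6 (λ a b c d e f →
                a :* (d :+ f) :+ b :* (c :+ e)
                := (a :* d :+ b :* c) :+ (a :* f :+ b :* e)) ≡.refl
                (seq (re z) n) (seq (im z) n) (seq (re w) n) (seq (im w) n) (seq (re v) n) (seq (im v) n))) ,
            (λ z w v → ≡⇒≈ᶜ ((w C.+ v) C.* z) (w C.* z C.+ v C.* z)
              (λ n → solve 6 (λ a b c d e f →
                (c :+ e) :* a :+ :- ((d :+ f) :* b)
                := (c :* a :+ :- (d :* b)) :+ (e :* a :+ :- (f :* b))) ≡.refl
                (seq (re z) n) (seq (im z) n) (seq (re w) n) (seq (im w) n) (seq (re v) n) (seq (im v) n))
              (λ n → solve 6 (λ a b c d e f →
                (c :+ e) :* b :+ (d :+ f) :* a
                := (c :* b :+ d :* a) :+ (e :* b :+ f :* a)) ≡.refl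
                (seq (re z) n) (seq (im z) n) (seq (re w) n) (seq (im w) n) (seq (re v) n) (seq (im v) n)))
        }
      ; *-comm = λ z w → ≡⇒≈ᶜ (z C.* w) (w C.* z)
          (λ n → solve 4 (λ a b c d → a :* c :+ :- (b :* d) := c :* a :+ :- (d :* b)) ≡.refl
            (seq (re z) n) (seq (im z) n) (seq (re w) n) (seq (im w) n))
          (λ n → solve 4 (λ a b c d → a :* d :+ b :* c := c :* b :+ d :* a) ≡.refl
            (seq (re z) n) (seq (im z) n) (seq (re w) n) (seq (im w) n))
      }

  -- The real part is `‖ z ‖²` times a reciprocal truncated at `ε`, hence equal to 1 only from `N`
  -- on; the imaginary part vanishes at every index.
  ⁻¹-inverseʳ : ∀ z (z#0 : z #0) → z C.* z ⁻¹⟨ z#0 ⟩ ≈ᶜ C.1#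
  ⁻¹-inverseʳ z z#0@(ε , N , 0<ε , ε≤) =
    eventually-≡⇒≈ᴿ {re (z C.* z ⁻¹⟨ z#0 ⟩)} {re C.1#} N (λ n N≤n → ≡.trans
      (solve 3 (λ a b r → a :* (a :* r) :+ :- (b :* (:- (b :* r))) := (a :* a :+ b :* b) :* r) ≡.refl
        (seq (re z) n) (seq (im z) n) (recip⊔ ε 0<ε (seq ‖ z ‖² n)))
      (recip⊔-inverse ε 0<ε (seq ‖ z ‖² n) (≡.subst (ℚ._≤ seq ‖ z ‖² n) (ℚ.+-identityˡ ε) (ε≤ n N≤n)))) ,
    ≡⇒≈ᴿ (im (z C.* z ⁻¹⟨ z#0 ⟩)) (im C.1#) (λ n →
      solve 3 (λ a b r → a :* (:- (b :* r)) :+ b :* (a :* r) := con 0ℚ) ≡.refl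
        (seq (re z) n) (seq (im z) n) (recip⊔ ε 0<ε (seq ‖ z ‖² n)))

  module K = IsCommutativeRing ℂ-isCommutativeRing
  open Finite ℂ-rawRing using (_^_; _-_)

  -- Bounds on squared norms.

  ∣_∣²⟨_⟩ : ℂ → ℕ → ℚ
  ∣ z ∣²⟨ n ⟩ = seq ‖ z ‖² n

  norm-cong : ∀ {z w} → z ≈ᶜ w → ‖ z ‖² ≈ᴿ ‖ w ‖²
  norm-cong {a +i b} {c +i d} (a≈c , b≈d) =
    +ᴿ-cong {a *ᴿ a} {c *ᴿ c} {b *ᴿ b} {d *ᴿ d}
      (*ᴿ-cong {a} {c} {a} {c} a≈c a≈c) (*ᴿ-cong {b} {d} {b} {d} b≈d b≈d)

  norm-nonNeg : ∀ z n → 0ℚ ℚ.≤ ∣ z ∣²⟨ n ⟩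
  norm-nonNeg z n = ℚ.+-mono-≤ (sq-nonNeg (seq (re z) n)) (sq-nonNeg (seq (im z) n))

  norm-* : ∀ z w n → ∣ z C.* w ∣²⟨ n ⟩ ≡ ∣ z ∣²⟨ n ⟩ ℚ.* ∣ w ∣²⟨ n ⟩
  norm-* z w n = solve 4
    (λ a b c d → (a :* c :+ :- (b :* d)) :* (a :* c :+ :- (b :* d)) :+ (a :* d :+ b :* c) :* (a :* d :+ b :* c)
              := (a :* a :+ b :* b) :* (c :* c :+ d :* d)) ≡.refl
    (seq (re z) n) (seq (im z) n) (seq (re w) n) (seq (im w) n)

  norm-neg : ∀ z n → ∣ C.- z ∣²⟨ n ⟩ ≡ ∣ z ∣²⟨ n ⟩
  norm-neg z n = solve 2 (λ a b → :- a :* :- a :+ :- b :* :- b := a :* a :+ b :* b) ≡.refl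
    (seq (re z) n) (seq (im z) n)

  -- |z + w|² + |z - w|² = 2 (|z|² + |w|²)
  norm-+ : ∀ z w n → ∣ z C.+ w ∣²⟨ n ⟩ ℚ.≤ (1ℚ ℚ.+ 1ℚ) ℚ.* (∣ z ∣²⟨ n ⟩ ℚ.+ ∣ w ∣²⟨ n ⟩)
  norm-+ z w n = ≡.subst (∣ z C.+ w ∣²⟨ n ⟩ ℚ.≤_)
    (solve 4 (λ a b c d →
       ((a :+ c) :* (a :+ c) :+ (b :+ d) :* (b :+ d)) :+ ((a :+ :- c) :* (a :+ :- c) :+ (b :+ :- d) :* (b :+ :- d))
       := (con 1ℚ :+ con 1ℚ) :* ((a :* a :+ b :* b) :+ (c :* c :+ d :* d))) ≡.refl
       (seq (re z) n) (seq (im z) n) (seq (re w) n) (seq (im w) n))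
    (p≤p+q ∣ z C.+ w ∣²⟨ n ⟩ (norm-nonNeg (z - w) n))

  -- `B` is uniform in `N`, while the stage `M` from which the approximations of `r N` obey it may
  -- depend on `N`.
  Bounded : (ℕ → ℂ) → Set
  Bounded r = ∃[ B ] (0ℚ ℚ.< B × (∀ N → ∃[ M ] (∀ n → M ℕ.≤ n → ∣ r N ∣²⟨ n ⟩ ℚ.≤ B)))

  bounded-resp : ∀ r s → (∀ N → r N ≡ s N) → Bounded s → Bounded r
  bounded-resp r s r≡s (B , 0<B , s≤B) = B , 0<B , λ N →
    ≡.subst (λ z → ∃[ M ] (∀ n → M ℕ.≤ n → ∣ z ∣²⟨ n ⟩ ℚ.≤ B)) (≡.sym (r≡s N)) (s≤B N)

  bounded-const : ∀ c → Bounded (λ _ → c)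
  bounded-const c = let B , M , 0<B , ≤B = cauchy-bounded (seq ‖ c ‖²) (cauchy ‖ c ‖²)
    in B , 0<B , λ _ → M , λ n M≤n → ℚ.≤-trans (p≤∣p∣ ∣ c ∣²⟨ n ⟩) (≤B n M≤n)

  bounded-* : ∀ r s → Bounded r → Bounded s → Bounded (λ N → r N C.* s N)
  bounded-* r s (A , 0<A , r≤A) (B , 0<B , s≤B) = A ℚ.* B , *-pos 0<A 0<B , λ N →
    let M₁ , r≤ = r≤A N
        M₂ , s≤ = s≤B N
    in M₁ ℕ.⊔ M₂ , λ n ≤n → ≡.subst (ℚ._≤ A ℚ.* B) (≡.sym (norm-* (r N) (s N) n))
         (*-mono-≤ (ℚ.<⇒≤ 0<A) (norm-nonNeg (s N) n)
           (r≤ n (ℕ.m⊔n≤o⇒m≤o M₁ M₂ ≤n)) (s≤ n (ℕ.m⊔n≤o⇒n≤o M₁ M₂ ≤n)))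

  bounded-+ : ∀ r s → Bounded r → Bounded s → Bounded (λ N → r N C.+ s N)
  bounded-+ r s (A , 0<A , r≤A) (B , 0<B , s≤B) =
    (1ℚ ℚ.+ 1ℚ) ℚ.* (A ℚ.+ B) , *-pos (ℚ.positive⁻¹ (1ℚ ℚ.+ 1ℚ)) (ℚ.+-mono-< 0<A 0<B) , λ N →
    let M₁ , r≤ = r≤A N
        M₂ , s≤ = s≤B N
    in M₁ ℕ.⊔ M₂ , λ n ≤n → ℚ.≤-trans (norm-+ (r N) (s N) n)
         (*-monoˡ-≤ (1ℚ ℚ.+ 1ℚ) (ℚ.<⇒≤ (ℚ.positive⁻¹ (1ℚ ℚ.+ 1ℚ)))
           (ℚ.+-mono-≤ (r≤ n (ℕ.m⊔n≤o⇒m≤o M₁ M₂ ≤n)) (s≤ n (ℕ.m⊔n≤o⇒n≤o M₁ M₂ ≤n))))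

  bounded-neg : ∀ r → Bounded r → Bounded (λ N → C.- r N)
  bounded-neg r (B , 0<B , r≤B) = B , 0<B , λ N → let M , r≤ = r≤B N in
    M , λ n M≤n → ≡.subst (ℚ._≤ B) (≡.sym (norm-neg (r N) n)) (r≤ n M≤n)

  ⟶-eventually : ∀ {v l} M → (∀ N → M ℕ.≤ N → v N ≈ᶜ l) → v ⟶ l
  ⟶-eventually {v} {l} M v≈l ε 0<ε = M , λ N M≤N →
    <ᴿ-respˡ-≈ᴿ {‖ v N - l ‖²} {‖ C.0# ‖²} {constᴿ (ε ℚ.* ε)}
      (norm-cong {v N - l} {C.0#} (K.trans {v N - l} {l - l} {C.0#}
        (K.+-cong {v N} {l} {C.- l} {C.- l} (v≈l N M≤N) (K.refl {C.- l})) (K.-‿inverseʳ l)))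
      (ε ℚ.* ε , 0 , *-pos 0<ε 0<ε , λ _ _ → ℚ.≤-reflexive (ℚ.+-identityˡ (ε ℚ.* ε)))

  -- Decay of the powers of q.

  module _ (q : ℂ) (∣q∣<1 : ∣ q ∣< 1ℚ) where

    private
      gap = proj₁ ∣q∣<1
      start = proj₁ (proj₂ ∣q∣<1)
      0<gap : 0ℚ ℚ.< gap
      0<gap = proj₁ (proj₂ (proj₂ ∣q∣<1))

      ∣q∣²+gap≤1 : ∀ n → start ℕ.≤ n → ∣ q ∣²⟨ n ⟩ ℚ.+ gap ℚ.≤ 1ℚ
      ∣q∣²+gap≤1 = proj₂ (proj₂ (proj₂ ∣q∣<1))

      0≤ℕ→ℚ*gap : ∀ k → 0ℚ ℚ.≤ ℕ→ℚ k ℚ.* gap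
      0≤ℕ→ℚ*gap k = *-nonNeg (ℕ→ℚ-mono {0} {k} ℕ.z≤n) (ℚ.<⇒≤ 0<gap)

    -- Bernoulli: (1 + k gap) (1 - gap)ᵏ ≤ 1.
    bernoulli : ∀ k n → start ℕ.≤ n → ∣ q ^ k ∣²⟨ n ⟩ ℚ.* (1ℚ ℚ.+ ℕ→ℚ k ℚ.* gap) ℚ.≤ 1ℚ
    bernoulli zero    n ≤n = ℚ.≤-reflexive (≡.trans (ℚ.*-identityˡ (1ℚ ℚ.+ 0ℚ ℚ.* gap))
      (≡.trans (≡.cong (1ℚ ℚ.+_) (ℚ.*-zeroˡ gap)) (ℚ.+-identityʳ 1ℚ)))
    bernoulli (suc k) n ≤n = begin
      ∣ q ^ suc k ∣²⟨ n ⟩ ℚ.* (1ℚ ℚ.+ ℕ→ℚ (suc k) ℚ.* gap)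
        ≡⟨ ≡.cong₂ (λ a b → a ℚ.* (1ℚ ℚ.+ b ℚ.* gap)) (norm-* q (q ^ k) n) (ℕ→ℚ-suc k) ⟩
      (s ℚ.* t) ℚ.* (1ℚ ℚ.+ (1ℚ ℚ.+ ℕ→ℚ k) ℚ.* gap)
        ≡⟨ solve 4 (λ s t k g → (s :* t) :* (con 1ℚ :+ (con 1ℚ :+ k) :* g)
             := (t :* (con 1ℚ :+ (con 1ℚ :+ k) :* g)) :* s) ≡.refl s t (ℕ→ℚ k) gap ⟩
      (t ℚ.* (1ℚ ℚ.+ (1ℚ ℚ.+ ℕ→ℚ k) ℚ.* gap)) ℚ.* s
        ≤⟨ *-monoˡ-≤ _ (*-nonNeg 0≤t 0≤1+) s≤1-gap ⟩
      (t ℚ.* (1ℚ ℚ.+ (1ℚ ℚ.+ ℕ→ℚ k) ℚ.* gap)) ℚ.* (1ℚ ℚ.- gap)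
        -- (1 + (1 + k) gap)(1 - gap) falls short of 1 + k gap by (1 + k) gap², which is the term
        -- added here, times `t`.
        ≤⟨ p≤p+q _ (*-nonNeg (*-nonNeg 0≤t (sq-nonNeg gap)) 0≤1+k) ⟩
      (t ℚ.* (1ℚ ℚ.+ (1ℚ ℚ.+ ℕ→ℚ k) ℚ.* gap)) ℚ.* (1ℚ ℚ.- gap)
        ℚ.+ t ℚ.* (gap ℚ.* gap) ℚ.* (1ℚ ℚ.+ ℕ→ℚ k)
        ≡⟨ solve 3 (λ t k g →
             (t :* (con 1ℚ :+ (con 1ℚ :+ k) :* g)) :* (con 1ℚ :- g) :+ t :* (g :* g) :* (con 1ℚ :+ k)
             := t :* (con 1ℚ :+ k :* g)) ≡.refl t (ℕ→ℚ k) gap ⟩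
      t ℚ.* (1ℚ ℚ.+ ℕ→ℚ k ℚ.* gap)
        ≤⟨ bernoulli k n ≤n ⟩
      1ℚ ∎
      where
      open ℚ.≤-Reasoning hiding (start)
      s = ∣ q ∣²⟨ n ⟩
      t = ∣ q ^ k ∣²⟨ n ⟩
      0≤t = norm-nonNeg (q ^ k) n
      0≤1+k : 0ℚ ℚ.≤ 1ℚ ℚ.+ ℕ→ℚ k
      0≤1+k = ℚ.+-mono-≤ (ℚ.<⇒≤ (ℚ.positive⁻¹ 1ℚ)) (ℕ→ℚ-mono {0} {k} ℕ.z≤n)
      0≤1+ : 0ℚ ℚ.≤ 1ℚ ℚ.+ (1ℚ ℚ.+ ℕ→ℚ k) ℚ.* gap
      0≤1+ = ℚ.+-mono-≤ (ℚ.<⇒≤ (ℚ.positive⁻¹ 1ℚ)) (*-nonNeg 0≤1+k (ℚ.<⇒≤ 0<gap))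
      s≤1-gap : s ℚ.≤ 1ℚ ℚ.- gap
      s≤1-gap = ≡.subst (ℚ._≤ 1ℚ ℚ.- gap) (solve 2 (λ s g → s :+ g :- g := s) ≡.refl s gap)
        (ℚ.+-monoˡ-≤ (ℚ.- gap) (∣q∣²+gap≤1 n ≤n))

    power-≤1 : ∀ k n → start ℕ.≤ n → ∣ q ^ k ∣²⟨ n ⟩ ℚ.≤ 1ℚ
    power-≤1 k n ≤n = ℚ.≤-trans
      (≡.subst₂ ℚ._≤_ (ℚ.*-identityʳ t) ≡.refl
        (*-monoˡ-≤ t (norm-nonNeg (q ^ k) n) (p≤p+q 1ℚ (0≤ℕ→ℚ*gap k))))
      (bernoulli k n ≤n)
      where t = ∣ q ^ k ∣²⟨ n ⟩

    bounded-power : Bounded (q ^_)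
    bounded-power = 1ℚ , ℚ.positive⁻¹ 1ℚ , λ k → start , power-≤1 k

    -- Once k δ gap ≥ 1, Bernoulli gives t ≤ t k δ gap ≤ δ t (1 + k gap) ≤ δ. The bound `M` does not
    -- depend on the index n, nor does the threshold on n depend on k.
    power-small : ∀ δ → 0ℚ ℚ.< δ →
      ∃[ M ] (∀ k → M ℕ.≤ k → ∀ n → start ℕ.≤ n → ∣ q ^ k ∣²⟨ n ⟩ ℚ.≤ δ)
    power-small δ 0<δ = let M , 1≤M = archimedean (δ ℚ.* gap) (*-pos 0<δ 0<gap) in
      M , λ k M≤k n ≤n →
      let t = ∣ q ^ k ∣²⟨ n ⟩
          0≤t = norm-nonNeg (q ^ k) n
      in begin
        t
          ≡⟨ ℚ.*-identityʳ t ⟨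
        t ℚ.* 1ℚ
          ≤⟨ *-monoˡ-≤ t 0≤t (ℚ.≤-trans 1≤M
               (ℚ.*-monoʳ-≤-nonNeg (δ ℚ.* gap) {{ℚ.nonNegative (ℚ.<⇒≤ (*-pos 0<δ 0<gap))}} (ℕ→ℚ-mono M≤k))) ⟩
        t ℚ.* (ℕ→ℚ k ℚ.* (δ ℚ.* gap))
          ≤⟨ p≤p+q _ (*-nonNeg (ℚ.<⇒≤ 0<δ) 0≤t) ⟩
        t ℚ.* (ℕ→ℚ k ℚ.* (δ ℚ.* gap)) ℚ.+ δ ℚ.* t
          ≡⟨ solve 4 (λ t k d g → t :* (k :* (d :* g)) :+ d :* t := d :* (t :* (con 1ℚ :+ k :* g)))
               ≡.refl t (ℕ→ℚ k) δ gap ⟩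
        δ ℚ.* (t ℚ.* (1ℚ ℚ.+ ℕ→ℚ k ℚ.* gap))
          ≤⟨ *-monoˡ-≤ δ (ℚ.<⇒≤ 0<δ) (bernoulli k n ≤n) ⟩
        δ ℚ.* 1ℚ
          ≡⟨ ℚ.*-identityʳ δ ⟩
        δ ∎
      where open ℚ.≤-Reasoning hiding (start)

    -- |q^N|² |r N|² ≤ (θ/B) B = θ with θ = ε²/2; the other half of ε² is the gap that `<ᴿ` demands.
    ⟶-power : ∀ {v l r} → Bounded r → (∀ N → v N ≈ᶜ l C.+ q ^ N C.* r N) → v ⟶ l
    ⟶-power {v} {l} {r} (B , 0<B , r≤B) v≈ ε 0<ε =
      let θ = ½ ℚ.* (ε ℚ.* ε)
          0<θ = half-pos (*-pos 0<ε 0<ε)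
          B⁻¹ , 0<B⁻¹ , inverse = pos-inverse B 0<B
          M , small = power-small (θ ℚ.* B⁻¹) (*-pos 0<θ 0<B⁻¹)
      in M , λ N M≤N → let M′ , r≤ = r≤B N in
        <ᴿ-respˡ-≈ᴿ {‖ v N - l ‖²} {‖ q ^ N C.* r N ‖²} {constᴿ (ε ℚ.* ε)}
          (norm-cong {v N - l} {q ^ N C.* r N} (difference N))
          (θ , start ℕ.⊔ M′ , 0<θ , λ n ≤n →
            let open ℚ.≤-Reasoning hiding (start) in begin
            ∣ q ^ N C.* r N ∣²⟨ n ⟩ ℚ.+ θ
              ≡⟨ ≡.cong (ℚ._+ θ) (norm-* (q ^ N) (r N) n) ⟩
            ∣ q ^ N ∣²⟨ n ⟩ ℚ.* ∣ r N ∣²⟨ n ⟩ ℚ.+ θ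
              ≤⟨ ℚ.+-monoˡ-≤ θ (*-mono-≤ (ℚ.<⇒≤ (*-pos 0<θ 0<B⁻¹)) (norm-nonNeg (r N) n)
                   (small N M≤N n (ℕ.m⊔n≤o⇒m≤o start M′ ≤n)) (r≤ n (ℕ.m⊔n≤o⇒n≤o start M′ ≤n))) ⟩
            (θ ℚ.* B⁻¹) ℚ.* B ℚ.+ θ
              ≡⟨ ≡.cong (ℚ._+ θ) (≡.trans (ℚ.*-assoc θ B⁻¹ B) (≡.trans
                   (≡.cong (θ ℚ.*_) (≡.trans (ℚ.*-comm B⁻¹ B) inverse)) (ℚ.*-identityʳ θ))) ⟩
            θ ℚ.+ θ
              ≡⟨ half+half (ε ℚ.* ε) ⟩
            ε ℚ.* ε ∎)
      where
      difference : ∀ N → v N - l ≈ᶜ q ^ N C.* r N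
      difference N = K.trans {v N - l} {(l C.+ w) - l} {w}
        (K.+-cong {v N} {l C.+ w} {C.- l} {C.- l} (v≈ N) (K.refl {C.- l}))
        (≡⇒≈ᶜ ((l C.+ w) - l) w
          (λ n → cancel (seq (re l) n) (seq (re w) n)) (λ n → cancel (seq (im l) n) (seq (im w) n)))
        where
        w = q ^ N C.* r N
        cancel : ∀ a b → (a ℚ.+ b) ℚ.- a ≡ b
        cancel = solve 2 (λ a b → (a :+ b) :- a := b) ≡.refl

-- Monomials and convergent sums in `ℂ⟦t,s⟧`.

open Complex
open Series ℂ-rawRing ℂ-isCommutativeRing
open Sums ℂ-rawRing ℂ-isCommutativeRing using (∑-stable; ∑-cong; ∑-zero; diagonal)
open Polynomials using (P; h; 1/⟨q⨾q⟩)
-- Opened only once, since each opening makes its own copies of the operations, and comparing nested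
-- products built from different copies unfolds them down to ℚ. For the same reason, products of
-- series are spelled out in types only and inferred, by way of let, in terms.
open RawRing ⟦t,s⟧-rawRing
open Finite ⟦t,s⟧-rawRing using (_^_)
module FS = Finite ⟦t,s⟧-rawRing
module C = RawRing ℂ-rawRing
module FC = Finite ℂ-rawRing

monomial-const : ∀ c → Monomial 0 0 c (const c)
monomial-const c = record
  { coefficient = K.refl {c}
  ; off₁ = λ where
      zero    j 0≢0 → contradiction ≡.refl 0≢0
      (suc i) j _   → K.refl {C.0#}
  ; off₂ = λ where
      i       zero    0≢0 → contradiction ≡.refl 0≢0
      zero    (suc j) _   → K.refl {C.0#}
      (suc i) (suc j) _   → K.refl {C.0#}
  }

monomial-𝐭 : Monomial 1 0 C.1# 𝐭
monomial-𝐭 = record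
  { coefficient = K.refl {C.1#}
  ; off₁ = λ where
      zero          j _   → K.refl {C.0#}
      (suc zero)    j 1≢1 → contradiction ≡.refl 1≢1
      (suc (suc i)) j _   → K.refl {C.0#}
  ; off₂ = λ where
      i             zero    0≢0 → contradiction ≡.refl 0≢0
      zero          (suc j) _   → K.refl {C.0#}
      (suc zero)    (suc j) _   → K.refl {C.0#}
      (suc (suc i)) (suc j) _   → K.refl {C.0#}
  }

monomial-𝐬 : Monomial 0 1 C.1# 𝐬
monomial-𝐬 = record
  { coefficient = K.refl {C.1#}
  ; off₁ = λ where
      zero    j 0≢0 → contradiction ≡.refl 0≢0
      (suc i) j _   → K.refl {C.0#}
  ; off₂ = λ where
      zero    zero          _   → K.refl {C.0#}
      zero    (suc zero)    1≢1 → contradiction ≡.refl 1≢1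
      zero    (suc (suc j)) _   → K.refl {C.0#}
      (suc i) j             _   → K.refl {C.0#}
  }

monomial-* : ∀ {a b c F a′ b′ c′ G} → Monomial a b c F → Monomial a′ b′ c′ G →
  Monomial (a′ ℕ.+ a) (b′ ℕ.+ b) (c C.* c′) (F * G)
monomial-* {a} {b} {c} {F} {a′} {b′} {c′} {G} = Monomial-⊛ {a} {b} {c} {F} {a′} {b′} {c′} {G}

monomial-1 : Monomial 0 0 C.1# 1#
monomial-1 = monomial-const C.1#

monomial-- : ∀ {a b c F} → Monomial a b c F → Monomial a b (C.- c) (- F)
monomial-- {a} {b} {c} {F} = monomial-neg {a} {b} {c} {F}

monomial-^ : ∀ {a b c F} → Monomial a b c F → ∀ n →
  Monomial (n ℕ.* a) (n ℕ.* b) (c FC.^ n) (F ^ n)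
monomial-^ M zero = monomial-const C.1#
monomial-^ {a} {b} {c} M (suc n) =
  let M′ = monomial-* M (monomial-^ M n) in
  monomial-cong M′ (ℕ.+-comm (n ℕ.* a) a) (ℕ.+-comm (n ℕ.* b) b) (K.refl {c C.* c FC.^ n})

monomial-const^ : ∀ c n → Monomial 0 0 (c FC.^ n) (const c ^ n)
monomial-const^ c n =
  monomial-cong (monomial-^ (monomial-const c) n) (ℕ.*-zeroʳ n) (ℕ.*-zeroʳ n) (K.refl {c FC.^ n})

monomial-𝐭^ : ∀ n → Monomial n 0 C.1# (𝐭 ^ n)
monomial-𝐭^ n = monomial-cong (monomial-^ monomial-𝐭 n) (ℕ.*-identityʳ n) (ℕ.*-zeroʳ n) (1^n≈1 n)

monomial-𝐬^ : ∀ n → Monomial 0 n C.1# (𝐬 ^ n)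
monomial-𝐬^ n = monomial-cong (monomial-^ monomial-𝐬 n) (ℕ.*-zeroʳ n) (ℕ.*-identityʳ n) (1^n≈1 n)

monomial-term : ∀ {c F} → Monomial 0 0 c F → ∀ a b n m →
  Monomial n m (c C.* (C.1# C.* a) C.* (C.1# C.* b))
    (F * (𝐭 ^ n * const a) * (𝐬 ^ m * const b))
monomial-term {c} M a b n m =
  let M₁ = monomial-* (monomial-𝐭^ n) (monomial-const a)
      M₂ = monomial-* (monomial-𝐬^ m) (monomial-const b)
      M₃ = monomial-* (monomial-* M M₁) M₂
  in monomial-cong M₃ (ℕ.+-identityʳ n) (ℕ.+-identityʳ m) (K.refl {c C.* (C.1# C.* a) C.* (C.1# C.* b)})

-- The series `0#` is `const C.0#`, which reduces only after its indices are split; hence three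
-- cases for `zero`.
∑-coefficient : ∀ N F n m → FS.∑< N F n m ≡ FC.∑< N (λ i → F i n m)
∑-coefficient zero    F zero    zero    = ≡.refl
∑-coefficient zero    F zero    (suc m) = ≡.refl
∑-coefficient zero    F (suc n) m       = ≡.refl
∑-coefficient (suc N) F n       m       = ≡.cong (C._+ F N n m) (∑-coefficient N F n m)

-- Every coefficient receives finitely many summands, so its partial sums are constant from `M n m`
-- on and no estimate is involved.
hasSum-finite : ∀ k F {L} (M : ℕ → ℕ → ℕ) →
  (∀ n m i → M n m ℕ.≤ i → F (k ℕ.+ i) n m ≈ᶜ C.0#) →
  (∀ n m → FC.∑< (M n m) (λ i → F (k ℕ.+ i) n m) ≈ᶜ L n m) → HasSum≥ k F L
hasSum-finite k F {L} M F≈0 sum≈ n m =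
  ⟶-eventually {λ N → FS.∑< N (λ i → F (k ℕ.+ i)) n m} {L n m} (M n m) λ N M≤N →
  ≡.subst (_≈ᶜ L n m) (≡.sym (∑-coefficient N (λ i → F (k ℕ.+ i)) n m))
    (K.trans {FC.∑< N f} {FC.∑< (M n m) f} {L n m} (∑-stable {f} (M n m) N M≤N (F≈0 n m)) (sum≈ n m))
  where
  f : ℕ → ℂ
  f i = F (k ℕ.+ i) n m

-- At the coefficient (n , m) an exponent k + j > m or k + i > n contributes nothing, which gives
-- the cutoffs `suc m` and `suc n`; `partial i` is the inner sum cut off there.
hasSum-monomials : ∀ {F c} k → (∀ n m → Monomial n m (c n m) (F n m)) →
  HasSum≥² k F (shift k (λ i j → c (k ℕ.+ i) (k ℕ.+ j)))
hasSum-monomials {F} {c} k M =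
  partial ,
  (λ i → hasSum-finite k (F i) {partial i} (λ _ m → suc m)
    (λ n m j m<j → off₂ (M i (k ℕ.+ j)) n m (ℕ.<⇒≢ (ℕ.≤-trans m<j (ℕ.m≤n+m j k))))
    (λ n m → K.refl {partial i n m})) ,
  hasSum-finite k partial {shift k (λ i j → c (k ℕ.+ i) (k ℕ.+ j))} (λ n _ → suc n)
    (λ n m i n<i → ∑-zero {λ j → F (k ℕ.+ i) (k ℕ.+ j) n m} (suc m) λ j _ →
      off₁ (M (k ℕ.+ i) (k ℕ.+ j)) n m (ℕ.<⇒≢ (ℕ.≤-trans n<i (ℕ.m≤n+m i k))))
    (monomial-sum k {F} {c} M)
  where
  partial : ℕ → ℂ⟦t,s⟧
  partial i n m = FC.∑< (suc m) (λ j → F i (k ℕ.+ j) n m)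

-- The sums and the product of the theorem.

module _ (q x y : ℂ) (∣q∣<1 : ∣ q ∣< 1ℚ) where

  module L = Linearization ℂ-rawRing ℂ-isCommutativeRing q x y
    (1/⟨q⨾q⟩ q ∣q∣<1) (λ k → P q ∣q∣<1 k x y) (λ n → h q ∣q∣<1 n x y)
    (λ n → ⁻¹-inverseʳ (FC.⟨ q ⨾ q ⟩ n) (qfac-#0 q ∣q∣<1 n))
    (K.refl {C.1#}) (λ k → K.refl {P q ∣q∣<1 (suc k) x y})
    (λ n → ∑-cong {λ k → Polynomials.[_choose_] q ∣q∣<1 n k C.* P q ∣q∣<1 k x y} (suc n)
      λ k → K.refl {Polynomials.[_choose_] q ∣q∣<1 n k C.* P q ∣q∣<1 k x y})

  bounded-remainder : ∀ k → Bounded (λ N → L.remainder N k)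
  bounded-remainder zero    = bounded-const C.0#
  bounded-remainder (suc k) =
    bounded-* (λ _ → a) (λ N → x C.* (e C.+ (q FC.^ N C.* r N C.+ C.- (q FC.^ k C.* r N))))
      (bounded-const a)
      (bounded-* (λ _ → x) (λ N → e C.+ (q FC.^ N C.* r N C.+ C.- (q FC.^ k C.* r N)))
        (bounded-const x)
        (bounded-+ (λ _ → e) (λ N → q FC.^ N C.* r N C.+ C.- (q FC.^ k C.* r N))
          (bounded-const e)
          (bounded-+ (λ N → q FC.^ N C.* r N) (λ N → C.- (q FC.^ k C.* r N))
            (bounded-* (q FC.^_) r (bounded-power q ∣q∣<1) (bounded-remainder k))
            (bounded-neg (λ N → q FC.^ k C.* r N)
              (bounded-* (λ _ → q FC.^ k) r (bounded-const (q FC.^ k)) (bounded-remainder k))))))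
    where
    a e : ℂ
    a = FC.⟨ q ⨾ q ⟩ k C.* 1/⟨q⨾q⟩ q ∣q∣<1 (suc k)
    e = L.E x k
    r : ℕ → ℂ
    r N = L.remainder N k

  bounded-Δ-remainder : ∀ n m → Bounded (λ N → Δ (L.remainder N) n m)
  bounded-Δ-remainder n m = Sum.[ on-diagonal , off-diagonal ]′ (Δ-entry n m)
    where
    on-diagonal : ∃[ k ] (∀ e → Δ e n m ≡ e k) → Bounded (λ N → Δ (L.remainder N) n m)
    on-diagonal (k , eq) = bounded-resp (λ N → Δ (L.remainder N) n m) (λ N → L.remainder N k)
      (λ N → eq (L.remainder N)) (bounded-remainder k)
    off-diagonal : (∀ e → Δ e n m ≡ C.0#) → Bounded (λ N → Δ (L.remainder N) n m)
    off-diagonal eq = bounded-resp (λ N → Δ (L.remainder N) n m) (λ _ → C.0#)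
      (λ N → eq (L.remainder N)) (bounded-const C.0#)

  finite-product : ∀ a r → (∀ j → Monomial 1 1 (x C.* q FC.^ j) (a * r ^ j)) →
    ∀ N n m → FS.⟨_⨾_⟩_ a r N n m ≈ᶜ Δ (L.coefs N) n m
  finite-product a r M zero    = L.coefs-zero (monomial-const C.1#)
  finite-product a r M (suc N) =
    L.coefs-suc {FS.⟨_⨾_⟩_ a r N} {1#} {a * r ^ N} {1# FS.- a * r ^ N} N
      (finite-product a r M N) (monomial-const C.1#) (M N)
      (λ n m → K.refl {1# n m FC.- (a * r ^ N) n m})

  monomial-factor : ∀ N → Monomial 1 1 (x C.* q FC.^ N) (const x * 𝐬 * 𝐭 * const q ^ N)
  monomial-factor N =
    let M = monomial-* (monomial-* (monomial-* (monomial-const x) monomial-𝐬) monomial-𝐭)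
                       (monomial-const^ q N)
    in monomial-cong M ≡.refl ≡.refl
         (K.*-cong {x C.* C.1# C.* C.1#} {x} {q FC.^ N} {q FC.^ N}
           (K.trans {x C.* C.1# C.* C.1#} {x C.* C.1#} {x}
             (K.*-identityʳ (x C.* C.1#)) (K.*-identityʳ x))
           (K.refl {q FC.^ N}))

  -- A data type determines its parameters, so `infinite-product` recovers `a` and `r` from the type
  -- of `factors-xst` instead of from the product `a * r ^ j`.
  data Factors (a r : ℂ⟦t,s⟧) : Set where
    factors : (∀ j → Monomial 1 1 (x C.* q FC.^ j) (a * r ^ j)) → Factors a r

  factors-xst : Factors (const x * 𝐬 * 𝐭) (const q)
  factors-xst = factors monomial-factor

  infinite-product : ∀ {a r} → Factors a r → ⟨ a ⨾ r ⟩∞⟶ Δ (L.E x)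
  infinite-product {a} {r} (factors M) n m = ⟶-power q ∣q∣<1
    {λ N → FS.⟨_⨾_⟩_ a r N n m} {Δ (L.E x) n m} {λ N → Δ (L.remainder N) n m}
    (bounded-Δ-remainder n m) λ N →
    K.trans {FS.⟨_⨾_⟩_ a r N n m} {Δ (L.coefs N) n m}
      {Δ (L.E x) n m C.+ q FC.^ N C.* Δ (L.remainder N) n m}
      (finite-product a r M N n m) (L.Δ-remainder N n m)

  inner : ℕ → ℂ⟦t,s⟧
  inner k = shift k (λ i j → L.lhs-term k (k ℕ.+ i) (k ℕ.+ j))

  monomial-summand : ∀ k → Monomial 0 0 (L.E y k)
    ((- 1#) ^ k * const y ^ k * const q ^ (k C 2) * const (1/⟨q⨾q⟩ q ∣q∣<1 k))
  monomial-summand k =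
    let M₁ = monomial-cong {c′ = (C.- C.1#) FC.^ k} (monomial-^ (monomial-- monomial-1) k)
               (ℕ.*-zeroʳ k) (ℕ.*-zeroʳ k) (K.refl {(C.- C.1#) FC.^ k})
        M₂ = monomial-* (monomial-* M₁ (monomial-const^ y k)) (monomial-const^ q (k C 2))
        M₃ = monomial-* M₂ (monomial-const (1/⟨q⨾q⟩ q ∣q∣<1 k))
    in monomial-cong M₃ ≡.refl ≡.refl
         (K.*-cong {(C.- C.1#) FC.^ k C.* y FC.^ k C.* q FC.^ (k C 2)} {L.G y k}
                   {1/⟨q⨾q⟩ q ∣q∣<1 k} {1/⟨q⨾q⟩ q ∣q∣<1 k}
           (L.G-closed y k) (K.refl {1/⟨q⨾q⟩ q ∣q∣<1 k}))

  lhs : ℂ⟦t,s⟧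
  lhs = diagonal (λ k a b → L.E y k C.* L.lhs-term k (k ℕ.+ a) (k ℕ.+ b))

  -- `T k` is a constant series and merely scales `inner k`, whose factor (ts)ᵏ leaves no
  -- contribution from k > n.
  lhs-sum : {T : ℕ → ℂ⟦t,s⟧} → (∀ k → Monomial 0 0 (L.E y k) (T k)) →
    HasSum≥ 0 (λ k → T k * inner k) lhs
  lhs-sum {T} M = hasSum-finite 0 (λ k → T k * inner k) {lhs} (λ n _ → suc n)
    (λ n m k n<k → K.trans {(T k * inner k) n m} {L.E y k C.* inner k n m} {C.0#}
      (term k n m)
      (K.trans {L.E y k C.* inner k n m} {L.E y k C.* C.0#} {C.0#}
        (K.*-cong {L.E y k} {L.E y k} {inner k n m} {C.0#} (K.refl {L.E y k})
          (shift-<₁ k (λ i j → L.lhs-term k (k ℕ.+ i) (k ℕ.+ j)) n m n<k))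
        (K.zeroʳ (L.E y k))))
    (λ n m → K.trans {FC.∑< (suc n) (λ k → (T k * inner k) n m)}
        {FC.∑< (suc n) (λ k → shift k (term-coefficient k) n m)} {lhs n m}
      (∑-cong {λ k → (T k * inner k) n m} {λ k → shift k (term-coefficient k) n m} (suc n)
        λ k → K.trans {(T k * inner k) n m} {L.E y k C.* inner k n m} {shift k (term-coefficient k) n m}
          (term k n m) (*-shift (L.E y k) k (λ i j → L.lhs-term k (k ℕ.+ i) (k ℕ.+ j)) n m))
      (∑-shift term-coefficient n m))
    where
    term-coefficient : ℕ → ℂ⟦t,s⟧
    term-coefficient k a b = L.E y k C.* L.lhs-term k (k ℕ.+ a) (k ℕ.+ b)
    term : ∀ k n m → (T k * inner k) n m ≈ᶜ L.E y k C.* inner k n m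
    term k = constant-⊛ {L.E y k} {T k} (M k) (inner k)

  identity : lhs ≈ Δ (L.E x) * L.rhs-term
  identity n m = K.trans {lhs n m} {diagonal (λ k a b → L.E x k C.* L.rhs-term a b) n m}
    {(Δ (L.E x) * L.rhs-term) n m}
    (L.coefficient-identity n m)
    (K.sym {(Δ (L.E x) * L.rhs-term) n m} {diagonal (λ k a b → L.E x k C.* L.rhs-term a b) n m}
      (Δ-⊛ (L.E x) L.rhs-term n m))

monomial-lhs-term : ∀ q x y ∣q∣<1 k n m → Monomial n m (L.lhs-term q x y ∣q∣<1 k n m)
  (const (h q ∣q∣<1 (n ℕ.+ m ∸ k) x y)
    * (𝐭 ^ n * const (1/⟨q⨾q⟩ q ∣q∣<1 (n ∸ k)))
    * (𝐬 ^ m * const (1/⟨q⨾q⟩ q ∣q∣<1 (m ∸ k))))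
monomial-lhs-term q x y ∣q∣<1 k n m =
  let M = monomial-const (h q ∣q∣<1 (n ℕ.+ m ∸ k) x y)
      M′ = monomial-term M (1/⟨q⨾q⟩ q ∣q∣<1 (n ∸ k)) (1/⟨q⨾q⟩ q ∣q∣<1 (m ∸ k)) n m
  in M′

monomial-rhs-term : ∀ q x y ∣q∣<1 n m → Monomial n m (L.rhs-term q x y ∣q∣<1 n m)
  (const (h q ∣q∣<1 n x y) * const (h q ∣q∣<1 m x y)
    * (𝐭 ^ n * const (1/⟨q⨾q⟩ q ∣q∣<1 n))
    * (𝐬 ^ m * const (1/⟨q⨾q⟩ q ∣q∣<1 m)))
monomial-rhs-term q x y ∣q∣<1 n m =
  let M = monomial-* (monomial-const (h q ∣q∣<1 n x y)) (monomial-const (h q ∣q∣<1 m x y))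
      M′ = monomial-term M (1/⟨q⨾q⟩ q ∣q∣<1 n) (1/⟨q⨾q⟩ q ∣q∣<1 m) n m
  in M′

theorem3p3 : (q x y : ℂ) (∣q∣<1 : ∣ q ∣< 1ℚ) →
    Σ[ inner ∈ (ℕ → ℂ⟦t,s⟧) ] ∃[ lhs ] ∃[ product ] ∃[ double ]
      (∀ k → HasSum≥² k
        (λ n m → const (h q ∣q∣<1 (n ℕ.+ m ∸ k) x y)
                   * (𝐭 ^ n * const (1/⟨q⨾q⟩ q ∣q∣<1 (n ∸ k)))
                   * (𝐬 ^ m * const (1/⟨q⨾q⟩ q ∣q∣<1 (m ∸ k))))
        (inner k))
      × HasSum≥ 0
        (λ k → (- 1#) ^ k * const y ^ k * const q ^ (k C 2) * const (1/⟨q⨾q⟩ q ∣q∣<1 k) * inner k)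
        lhs
      × ⟨ const x * 𝐬 * 𝐭 ⨾ const q ⟩∞⟶ product
      × HasSum≥² 0
        (λ n m → const (h q ∣q∣<1 n x y) * const (h q ∣q∣<1 m x y)
                   * (𝐭 ^ n * const (1/⟨q⨾q⟩ q ∣q∣<1 n))
                   * (𝐬 ^ m * const (1/⟨q⨾q⟩ q ∣q∣<1 m)))
        double
      × lhs ≈ product * double
theorem3p3 q x y ∣q∣<1 =
  let inner-sum  = λ k → hasSum-monomials k (monomial-lhs-term q x y ∣q∣<1 k)
      outer-sum  = lhs-sum q x y ∣q∣<1 (monomial-summand q x y ∣q∣<1)
      product    = infinite-product q x y ∣q∣<1 (factors-xst q x y ∣q∣<1)
      -- `shift 0` is the identity, so the double sum converges to `rhs-term` itself.
      double-sum = hasSum-monomials 0 (monomial-rhs-term q x y ∣q∣<1)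
  in inner q x y ∣q∣<1 , lhs q x y ∣q∣<1 , Δ (L.E q x y ∣q∣<1 x) , L.rhs-term q x y ∣q∣<1 ,
     inner-sum , outer-sum , product , double-sum , identity q x y ∣q∣<1
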